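{- Let $H$ be a cata-condensed hexagonal system. Then the anti-forcing spectrum of $H$ is continuous, i.e. the set $\mathrm{Spec}_{af}(H)$ is an integer interval.
   Context: A hexagonal system is a finite 2-connected plane bipartite graph in which every interior face is bounded by a regular hexagon of side length one; these faces are its hexagons. $H$ is cata-condensed if the graph whose vertices are the hexagons, two adjacent iff they share an edge, is a tree. For a perfect matching $M$ of $H$, the anti-forcing number $af(H,M)$ is the minimum number of edges not in $M$ whose removal from $H$ leaves a graph in which $M$ is the unique perfect matching. The anti-forcing spectrum $\mathrm{Spec}_{af}(H)$ is the set $\{af(H,M): M \text{ a perfect matching of } H\}$; it is called continuous if it equals $\{a,a+1,\dots,b\}$ for some integers $a\le b$. -}

module Defs where

open import Data.Integer using (ℤ; +_; _+_; _*_)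
open import Data.Nat using (ℕ; _≤_)
open import Data.Product using (Σ; ∃; ∃-syntax; _×_; _,_)
open import Data.Sum using (_⊎_)
open import Data.List using (List; []; _∷_; length; _∷ʳ_)
open import Data.List.Membership.Propositional using (_∈_; _∉_)
open import Data.List.Relation.Unary.All using (All)
open import Data.List.Relation.Unary.Unique.Propositional using (Unique)
open import Data.List.Relation.Unary.Linked using (Linked)
open import Relation.Binary.PropositionalEquality using (_≡_; _≢_)
open import Relation.Nullary using (¬_)
open import Function.Bundles using (_⇔_)

-- The hexagonal (honeycomb) lattice, in "brick-wall" coordinates.
-- Lattice vertices are points (x , y) ∈ ℤ².  Lattice edges are
--   hor x y : (x , y) — (x+1 , y)      (all x, y)
--   ver x y : (x , y) — (x , y+1)      (only x + y even occurs)
-- The hexagonal face (cell) with coordinates (i , j) ∈ ℤ² has lower-left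
-- corner (X , j) with X = 2i + j, and is the 6-cycle
--   (X,j)-(X+1,j)-(X+2,j)-(X+2,j+1)-(X+1,j+1)-(X,j+1)-(X,j).
-- Every hexagonal system is (up to congruence) a finite set of such cells.

Vertex : Set
Vertex = ℤ × ℤ

data Edge : Set where
  hor : ℤ → ℤ → Edge
  ver : ℤ → ℤ → Edge

Hex : Set
Hex = ℤ × ℤ

private
  one two : ℤ
  one = + 1
  two = + 2

corner : Hex → ℤ
corner (i , j) = two * i + j

hexEdges : Hex → List Edge
hexEdges h@(i , j) =
  let X = corner h in
  hor X j ∷ hor (X + one) j ∷ hor X (j + one) ∷ hor (X + one) (j + one)
    ∷ ver X j ∷ ver (X + two) j ∷ []

hexVerts : Hex → List Vertex
hexVerts h@(i , j) =
  let X = corner h in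
  (X , j) ∷ (X + one , j) ∷ (X + two , j)
    ∷ (X , j + one) ∷ (X + one , j + one) ∷ (X + two , j + one) ∷ []

Incident : Vertex → Edge → Set
Incident v (hor x y) = v ≡ (x , y) ⊎ v ≡ (x + one , y)
Incident v (ver x y) = v ≡ (x , y) ⊎ v ≡ (x , y + one)

IsVertex : List Hex → Vertex → Set
IsVertex H v = ∃[ h ] (h ∈ H × v ∈ hexVerts h)

IsEdge : List Hex → Edge → Set
IsEdge H e = ∃[ h ] (h ∈ H × e ∈ hexEdges h)

Adjacent : Hex → Hex → Set
Adjacent h h' = h ≢ h' × ∃[ e ] (e ∈ hexEdges h × e ∈ hexEdges h')

data Walk (H : List Hex) : Hex → Hex → Set where
  here  : ∀ {h} → h ∈ H → Walk H h h
  there : ∀ {h h' h''} → h ∈ H → Adjacent h h' → Walk H h' h'' → Walk H h h''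

DualConnected : List Hex → Set
DualConnected H = ∀ {h h'} → h ∈ H → h' ∈ H → Walk H h h'

DualCycle : List Hex → Hex → List Hex → Set
DualCycle H x xs =
  2 ≤ length xs × Unique (x ∷ xs) × All (_∈ H) (x ∷ xs)
  × Linked Adjacent (x ∷ xs ∷ʳ x)

DualAcyclic : List Hex → Set
DualAcyclic H = ∀ x xs → ¬ DualCycle H x xs

-- Cata-condensed hexagonal system: a nonempty finite set of hexagons of
-- the lattice whose inner dual is a tree (connected and acyclic).
-- (A tree inner dual forces the union to be 2-connected, hole-free,
-- with interior faces exactly the chosen hexagons.)
CataCondensed : List Hex → Set
CataCondensed H = H ≢ [] × Unique H × DualConnected H × DualAcyclic H

-- Perfect matchings of a spanning subgraph of H whose edge set is G
-- (G is a predicate on edges, contained in the edges of H).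
-- A matching is given as a duplicate-free list of edges.

PerfectMatchingOf : List Hex → (Edge → Set) → List Edge → Set
PerfectMatchingOf H G M =
  Unique M × All G M ×
  (∀ v → IsVertex H v →
     (∃[ e ] (e ∈ M × Incident v e)) ×
     (∀ {e e'} → e ∈ M → e' ∈ M → Incident v e → Incident v e' → e ≡ e'))

PerfectMatching : List Hex → List Edge → Set
PerfectMatching H M = PerfectMatchingOf H (IsEdge H) M

AntiForcingSet : List Hex → List Edge → List Edge → Set
AntiForcingSet H M S =
  Unique S × All (λ e → IsEdge H e × e ∉ M) S ×
  (∀ M' → PerfectMatchingOf H (λ e → IsEdge H e × e ∉ S) M' →
     ∀ e → (e ∈ M' ⇔ e ∈ M))

AntiForcingNumber : List Hex → List Edge → ℕ → Set
AntiForcingNumber H M k =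
  (∃[ S ] (AntiForcingSet H M S × length S ≡ k)) ×
  (∀ S → AntiForcingSet H M S → k ≤ length S)

InSpecAf : List Hex → ℕ → Set
InSpecAf H k = ∃[ M ] (PerfectMatching H M × AntiForcingNumber H M k)

ContinuousSpecAf : List Hex → Set
ContinuousSpecAf H =
  ∃[ a ] ∃[ b ] (a ≤ b × (∀ k → InSpecAf H k ⇔ (a ≤ k × k ≤ b)))

{-# OPTIONS --safe #-}
module Submission where

-- Root the inner dual at a side whose hexagon has no neighbour there or at the two adjacent
-- sides. A hexagon entered through a side then has branches behind the opposite side only, or
-- behind some of the two sides next to it. Splitting matchings by what they do at the root
-- edge of each branch turns the anti-forcing number into a pair of numbers computed
-- recursively along the tree; the second one also charges for destroying all matchings of
-- the complementary kind. By induction on the tree, any two matchings are linked by a chain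
-- along which both numbers change by at most one per step, so no value is skipped.

open import Defs
open import Data.Bool using (Bool; true; false; not)
open import Data.Empty using (⊥; ⊥-elim)
open import Data.List using (List; []; _∷_; _++_; _∷ʳ_; map; length; cartesianProductWith)
open import Data.List.Extrema.Nat using (argmin; argmax; f[argmin]≤f[xs]; f[xs]≤f[argmax])
import Data.List.Membership.DecPropositional as DecMembership
open import Data.List.Membership.Propositional using (_∈_; _∉_)
open import Data.List.Membership.Propositional.Properties
  using (∈-∃++; ∈-++⁺ˡ; ∈-++⁺ʳ; ∈-++⁻; ∈-map⁺; ∈-cartesianProductWith⁺)
open import Data.List.Properties using (∷-injective; map-++; map-cong; length-map; length-++; ++-assoc)
open import Data.List.Relation.Unary.All as All using (All; []; _∷_)
import Data.List.Relation.Unary.All.Properties as All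
open import Data.List.Relation.Unary.AllPairs using ([]; _∷_)
open import Data.List.Relation.Unary.Any using (here; there)
open import Data.List.Relation.Unary.Linked using (Linked; [-]; _∷_)
open import Data.List.Relation.Unary.Unique.Propositional using (Unique)
open import Data.List.Relation.Unary.Unique.Propositional.Properties using (++⁺)
open import Data.Product using (Σ; ∃-syntax; _×_; _,_; proj₁; proj₂; uncurry)
open import Data.Product.Properties using (≡-dec)
open import Data.Sum using (_⊎_; inj₁; inj₂; [_,_]′)
open import Data.Unit using (⊤; tt)
open import Function using (case_of_; _⇔_; mk⇔; Equivalence)
open import Relation.Binary using (DecidableEquality)
open import Relation.Binary.Construct.Closure.ReflexiveTransitive using (Star; ε; _◅_; _◅◅_; gmap)
open import Relation.Binary.PropositionalEquality
open import Relation.Nullary using (¬_; Dec; yes; no; does)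
open import Relation.Nullary.Decidable using (map′; _×-dec_; _⊎-dec_; dec-true; dec-false)

-- The hexagonal lattice

-- How many cuts a branch needs depends on its parent: the parent may cut the shared root edge, or
-- spare the branch some work by cutting a side of its own hexagon. A single number per branch
-- therefore does not determine the number for the whole, and both coordinates must be controlled
-- along the chain. The obstacle is a hexagon with two branches. Its matchings with the root edge
-- are built from `MC` of the branches and those without it from `M0`, so no change inside one
-- branch links the two halves. Rotating the hexagon does link them, but it can change the value by
-- two, namely when both branches carry some `m` with `b0 m` equal to `1 + a0 m`. The passage is
-- therefore made at matchings prepared recursively, the `Seed`s, for which all the numbers involved
-- are known in terms of `a0` alone; there each coordinate moves by at most one. With one branch the
-- rotation is harmless everywhere. The geometry has to supply only that an edge lies in at most two
-- hexagons and a vertex in at most three, with known numberings. The two-colouring of the lattice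
-- excludes most false coincidences.

module Honeycomb where
  open import Data.Integer using (ℤ; +_; -[1+_]; _+_; _*_; -_; ∣_∣) renaming (_<_ to _<ℤ_)
  import Data.Integer.Properties as ℤ
  import Data.Nat.Properties as ℕ
  open import Algebra.Properties.AbelianGroup ℤ.+-0-abelianGroup using ()
    renaming (∙-cancelˡ to +-cancelˡ; ∙-cancelʳ to +-cancelʳ)
  open import Data.Integer.Tactic.RingSolver using (solve-∀)

  data Dir : Set where
    d0 d1 d2 d3 d4 d5 : Dir

  r r² r³ r⁴ r⁵ : Dir → Dir
  r d0 = d1
  r d1 = d2
  r d2 = d3
  r d3 = d4
  r d4 = d5
  r d5 = d0
  r² k = r (r k)
  r³ k = r (r² k)
  r⁴ k = r (r³ k)
  r⁵ k = r (r⁴ k)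

  r⁶ : ∀ k → r (r⁵ k) ≡ k
  r⁶ d0 = refl
  r⁶ d1 = refl
  r⁶ d2 = refl
  r⁶ d3 = refl
  r⁶ d4 = refl
  r⁶ d5 = refl

  all-dirs : ∀ {ℓ} {P : Dir → Set ℓ} → P d0 → P d1 → P d2 → P d3 → P d4 → P d5 → ∀ k → P k
  all-dirs a b c d e f d0 = a
  all-dirs a b c d e f d1 = b
  all-dirs a b c d e f d2 = c
  all-dirs a b c d e f d3 = d
  all-dirs a b c d e f d4 = e
  all-dirs a b c d e f d5 = f

  -- Lets a statement about a side `l` be split by its position relative to a fixed side `k`, so
  -- that the 36 pairs need not be listed.
  all-turns : ∀ {ℓ} {P : Dir → Set ℓ} k →
              P k → P (r k) → P (r² k) → P (r³ k) → P (r⁴ k) → P (r⁵ k) → ∀ l → P l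
  all-turns d0 a b c d e f = all-dirs a b c d e f
  all-turns d1 a b c d e f = all-dirs f a b c d e
  all-turns d2 a b c d e f = all-dirs e f a b c d
  all-turns d3 a b c d e f = all-dirs d e f a b c
  all-turns d4 a b c d e f = all-dirs c d e f a b
  all-turns d5 a b c d e f = all-dirs b c d e f a

  -- Sides, neighbours and corners are numbered counterclockwise; side k joins
  -- corner k to corner r k and is shared with the neighbour nbr h k.

  side : Hex → Dir → Edge
  side h@(i , j) d0 = hor (corner h) j
  side h@(i , j) d1 = hor (corner h + + 1) j
  side h@(i , j) d2 = ver (corner h + + 2) j
  side h@(i , j) d3 = hor (corner h + + 1) (j + + 1)
  side h@(i , j) d4 = hor (corner h) (j + + 1)
  side h@(i , j) d5 = ver (corner h) j

  vert : Hex → Dir → Vertex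
  vert h@(i , j) d0 = corner h , j
  vert h@(i , j) d1 = corner h + + 1 , j
  vert h@(i , j) d2 = corner h + + 2 , j
  vert h@(i , j) d3 = corner h + + 2 , j + + 1
  vert h@(i , j) d4 = corner h + + 1 , j + + 1
  vert h@(i , j) d5 = corner h , j + + 1

  δ : Dir → ℤ × ℤ
  δ d0 = + 0 , -[1+ 0 ]
  δ d1 = + 1 , -[1+ 0 ]
  δ d2 = + 1 , + 0
  δ d3 = + 0 , + 1
  δ d4 = -[1+ 0 ] , + 1
  δ d5 = -[1+ 0 ] , + 0

  nbr : Hex → Dir → Hex
  nbr (i , j) k = i + proj₁ (δ k) , j + proj₂ (δ k)

  -- Only the values at the six offsets matter. A left inverse of `δ` yields `nbr-inj` without
  -- comparing directions pairwise.
  δ⁻¹ : ℤ × ℤ → Dir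
  δ⁻¹ (+ 0 , -[1+ _ ])      = d0
  δ⁻¹ (+ _ , -[1+ _ ])      = d1
  δ⁻¹ (+ 0 , + _)           = d3
  δ⁻¹ (+ _ , + _)           = d2
  δ⁻¹ (-[1+ _ ] , + 0)      = d5
  δ⁻¹ (-[1+ _ ] , _)        = d4

  δ-inv : ∀ k → δ⁻¹ (δ k) ≡ k
  δ-inv = all-dirs refl refl refl refl refl refl

  nbr-inj : ∀ h {k l} → nbr h k ≡ nbr h l → k ≡ l
  nbr-inj (i , j) {k} {l} eq = trans (sym (δ-inv k)) (trans (cong δ⁻¹ δ≡) (δ-inv l))
    where
      δ≡ : δ k ≡ δ l
      δ≡ = cong₂ _,_ (+-cancelˡ i _ _ (cong proj₁ eq)) (+-cancelˡ j _ _ (cong proj₂ eq))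

  nbr≢ : ∀ h k → nbr h k ≢ h
  nbr≢ (i , j) k eq = go k (zero′ i (cong proj₁ eq)) (zero′ j (cong proj₂ eq))
    where
      zero′ : ∀ a {b} → a + b ≡ a → b ≡ + 0
      zero′ a e = +-cancelˡ a _ _ (trans e (sym (ℤ.+-identityʳ a)))
      go : ∀ k → proj₁ (δ k) ≡ + 0 → proj₂ (δ k) ≡ + 0 → ⊥
      go = all-dirs (λ _ ()) (λ ()) (λ ()) (λ _ ()) (λ ()) (λ ())

  side-nbr : ∀ h k → side (nbr h k) (r³ k) ≡ side h k
  side-nbr (i , j) = all-dirs
    (cong₂ hor (x₀ i j) (y₀ j)) (cong₂ hor (x₁ i j) (y₀ j)) (cong₂ ver (x₂ i j) (y₁ j))
    (cong₂ hor (x₃ i j) refl) (cong₂ hor (x₄ i j) refl) (cong₂ ver (x₅ i j) (y₁ j))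
    where
      y₀ : ∀ j → j + -[1+ 0 ] + + 1 ≡ j
      y₀ = solve-∀
      y₁ : ∀ j → j + + 0 ≡ j
      y₁ = solve-∀
      x₀ : ∀ i j → + 2 * (i + + 0) + (j + -[1+ 0 ]) + + 1 ≡ + 2 * i + j
      x₀ = solve-∀
      x₁ : ∀ i j → + 2 * (i + + 1) + (j + -[1+ 0 ]) ≡ + 2 * i + j + + 1
      x₁ = solve-∀
      x₂ : ∀ i j → + 2 * (i + + 1) + (j + + 0) ≡ + 2 * i + j + + 2
      x₂ = solve-∀
      x₃ : ∀ i j → + 2 * (i + + 0) + (j + + 1) ≡ + 2 * i + j + + 1
      x₃ = solve-∀
      x₄ : ∀ i j → + 2 * (i + -[1+ 0 ]) + (j + + 1) + + 1 ≡ + 2 * i + j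
      x₄ = solve-∀
      x₅ : ∀ i j → + 2 * (i + -[1+ 0 ]) + (j + + 0) + + 2 ≡ + 2 * i + j
      x₅ = solve-∀

  nbr-nbr : ∀ h k l m → δ k .proj₁ + δ l .proj₁ ≡ δ m .proj₁ → δ k .proj₂ + δ l .proj₂ ≡ δ m .proj₂ →
            nbr (nbr h k) l ≡ nbr h m
  nbr-nbr (i , j) k l m p q =
    cong₂ _,_ (trans (ℤ.+-assoc i _ _) (cong (λ z → i + z) p)) (trans (ℤ.+-assoc j _ _) (cong (λ z → j + z) q))

  nbr-left : ∀ h k → nbr (nbr h k) (r² k) ≡ nbr h (r k)
  nbr-left h k = nbr-nbr h k (r² k) (r k)
    (all-dirs {P = λ k → δ k .proj₁ + δ (r² k) .proj₁ ≡ δ (r k) .proj₁} refl refl refl refl refl refl k)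
    (all-dirs {P = λ k → δ k .proj₂ + δ (r² k) .proj₂ ≡ δ (r k) .proj₂} refl refl refl refl refl refl k)

  nbr-right : ∀ h k → nbr (nbr h k) (r⁴ k) ≡ nbr h (r⁵ k)
  nbr-right h k = nbr-nbr h k (r⁴ k) (r⁵ k)
    (all-dirs {P = λ k → δ k .proj₁ + δ (r⁴ k) .proj₁ ≡ δ (r⁵ k) .proj₁} refl refl refl refl refl refl k)
    (all-dirs {P = λ k → δ k .proj₂ + δ (r⁴ k) .proj₂ ≡ δ (r⁵ k) .proj₂} refl refl refl refl refl refl k)

  nbr-back : ∀ h k → nbr (nbr h k) (r³ k) ≡ h
  nbr-back (i , j) k = cong₂ _,_
    (trans (ℤ.+-assoc i _ _) (trans (cong (λ z → i + z)
      (all-dirs {P = λ k → δ k .proj₁ + δ (r³ k) .proj₁ ≡ + 0} refl refl refl refl refl refl k)) (ℤ.+-identityʳ i)))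
    (trans (ℤ.+-assoc j _ _) (trans (cong (λ z → j + z)
      (all-dirs {P = λ k → δ k .proj₂ + δ (r³ k) .proj₂ ≡ + 0} refl refl refl refl refl refl k)) (ℤ.+-identityʳ j)))

  2*-inj : ∀ a b → + 2 * a ≡ + 2 * b → a ≡ b
  2*-inj a b = ℤ.*-cancelˡ-≡ (+ 2) a b

  even≢odd : ∀ a b → + 2 * a ≢ + 2 * b + + 1
  even≢odd a b eq = ℕ.even≢odd ∣ a + - b ∣ 0
    (trans (sym (ℤ.abs-* (+ 2) (a + - b))) (cong ∣_∣ (trans (l a b) (trans (cong (λ z → z + - (+ 2 * b)) eq) (m b)))))
    where
      l : ∀ a b → + 2 * (a + - b) ≡ + 2 * a + - (+ 2 * b)
      l = solve-∀
      m : ∀ b → + 2 * b + + 1 + - (+ 2 * b) ≡ + 1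
      m = solve-∀

  corner-inj : ∀ {i i′ j j′} c → + 2 * i + j + c ≡ + 2 * i′ + j′ + c → j ≡ j′ → (i , j) ≡ (i′ , j′)
  corner-inj {i} {i′} {j} c p refl =
    cong (_, j) (2*-inj i i′ (+-cancelʳ j _ _ (+-cancelʳ c _ _ p)))

  corner-inj₀ : ∀ {i i′ j j′} → + 2 * i + j ≡ + 2 * i′ + j′ → j ≡ j′ → (i , j) ≡ (i′ , j′)
  corner-inj₀ {i} {i′} {j} p refl = cong (_, j) (2*-inj i i′ (+-cancelʳ j _ _ p))

  hor-inj : ∀ {x y x′ y′} → hor x y ≡ hor x′ y′ → x ≡ x′ × y ≡ y′
  hor-inj refl = refl , refl

  ver-inj : ∀ {x y x′ y′} → ver x y ≡ ver x′ y′ → x ≡ x′ × y ≡ y′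
  ver-inj refl = refl , refl

  pair-inj : ∀ {x y x′ y′ : ℤ} → (x , y) ≡ (x′ , y′) → x ≡ x′ × y ≡ y′
  pair-inj refl = refl , refl

  side-hex-inj : ∀ b h k → side b k ≡ side h k → b ≡ h
  side-hex-inj b h d0 e = let p , q = hor-inj e in corner-inj₀ p q
  side-hex-inj b h d1 e = let p , q = hor-inj e in corner-inj (+ 1) p q
  side-hex-inj b h d2 e = let p , q = ver-inj e in corner-inj (+ 2) p q
  side-hex-inj b h d3 e = let p , q = hor-inj e in corner-inj (+ 1) p (+-cancelʳ (+ 1) _ _ q)
  side-hex-inj b h d4 e = let p , q = hor-inj e in corner-inj₀ p (+-cancelʳ (+ 1) _ _ q)
  side-hex-inj b h d5 e = let p , q = ver-inj e in corner-inj₀ p q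

  vert-hex-inj : ∀ b h k → vert b k ≡ vert h k → b ≡ h
  vert-hex-inj b h d0 e = let p , q = pair-inj e in corner-inj₀ p q
  vert-hex-inj b h d1 e = let p , q = pair-inj e in corner-inj (+ 1) p q
  vert-hex-inj b h d2 e = let p , q = pair-inj e in corner-inj (+ 2) p q
  vert-hex-inj b h d3 e = let p , q = pair-inj e in corner-inj (+ 2) p (+-cancelʳ (+ 1) _ _ q)
  vert-hex-inj b h d4 e = let p , q = pair-inj e in corner-inj (+ 1) p (+-cancelʳ (+ 1) _ _ q)
  vert-hex-inj b h d5 e = let p , q = pair-inj e in corner-inj₀ p (+-cancelʳ (+ 1) _ _ q)

  odd : Dir → Bool
  odd d0 = false
  odd d1 = true
  odd d2 = false
  odd d3 = true
  odd d4 = false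
  odd d5 = true

  Parity : Bool → ℤ → Set
  Parity false z = ∃[ m ] z ≡ + 2 * m
  Parity true  z = ∃[ m ] z ≡ + 2 * m + + 1

  parity-unique : ∀ {a b z} → Parity a z → Parity b z → a ≡ b
  parity-unique {false} {false} _ _ = refl
  parity-unique {true}  {true}  _ _ = refl
  parity-unique {false} {true}  (m , p) (n , q) = ⊥-elim (even≢odd m n (trans (sym p) q))
  parity-unique {true}  {false} (m , p) (n , q) = ⊥-elim (even≢odd n m (trans (sym q) p))

  -- This is the bipartition of the lattice: colours alternate round every hexagon, so the colour of
  -- a corner is the parity of its number. Corners whose numbers differ in parity are thereby
  -- distinct, whichever hexagons they belong to.
  vert-parity : ∀ h k → Parity (odd k) (proj₁ (vert h k) + proj₂ (vert h k))
  vert-parity (i , j) = all-dirs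
    (i + j , p₀ i j) (i + j , p₁ i j) (i + j + + 1 , p₂ i j) (i + j + + 1 , p₃ i j) (i + j + + 1 , p₄ i j) (i + j , p₅ i j)
    where
      p₀ : ∀ i j → + 2 * i + j + j ≡ + 2 * (i + j)
      p₀ = solve-∀
      p₁ : ∀ i j → + 2 * i + j + + 1 + j ≡ + 2 * (i + j) + + 1
      p₁ = solve-∀
      p₂ : ∀ i j → + 2 * i + j + + 2 + j ≡ + 2 * (i + j + + 1)
      p₂ = solve-∀
      p₃ : ∀ i j → + 2 * i + j + + 2 + (j + + 1) ≡ + 2 * (i + j + + 1) + + 1
      p₃ = solve-∀
      p₄ : ∀ i j → + 2 * i + j + + 1 + (j + + 1) ≡ + 2 * (i + j + + 1)
      p₄ = solve-∀
      p₅ : ∀ i j → + 2 * i + j + (j + + 1) ≡ + 2 * (i + j) + + 1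
      p₅ = solve-∀

  vert-odd : ∀ b l h k → vert b l ≡ vert h k → odd l ≡ odd k
  vert-odd b l h k e = parity-unique (vert-parity b l)
    (subst (λ v → Parity (odd k) (proj₁ v + proj₂ v)) (sym e) (vert-parity h k))

  -- The corner from which Defs draws side k.
  anchor : Dir → Dir
  anchor d0 = d0
  anchor d1 = d1
  anchor d2 = d2
  anchor d3 = d4
  anchor d4 = d5
  anchor d5 = d0

  source : Edge → Vertex
  source (hor x y) = x , y
  source (ver x y) = x , y

  side-source : ∀ h k → source (side h k) ≡ vert h (anchor k)
  side-source h = all-dirs refl refl refl refl refl refl

  side-odd : ∀ b l h k → side b l ≡ side h k → odd (anchor l) ≡ odd (anchor k)
  side-odd b l h k e = vert-odd b (anchor l) h (anchor k)
    (trans (sym (side-source b l)) (trans (cong source e) (side-source h k)))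

  side-r : ∀ b h k → side b (r k) ≢ side h k
  side-r b h d0 e = case side-odd b d1 h d0 e of λ ()
  side-r b h d1 ()
  side-r b h d2 ()
  side-r b h d3 e = case side-odd b d4 h d3 e of λ ()
  side-r b h d4 ()
  side-r b h d5 ()

  side-r² : ∀ b h k → side b (r² k) ≢ side h k
  side-r² b h d0 ()
  side-r² b h d1 e = case side-odd b d3 h d1 e of λ ()
  side-r² b h d2 ()
  side-r² b h d3 ()
  side-r² b h d4 e = case side-odd b d0 h d4 e of λ ()
  side-r² b h d5 ()

  side-r³ : ∀ b h k → side b (r³ k) ≡ side h k → b ≡ nbr h k
  side-r³ b h k e = side-hex-inj b (nbr h k) (r³ k) (trans e (sym (side-nbr h k)))

  -- Turning by one or two places changes the orientation of the edge or the colour of its `source`,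
  -- so only equal or opposite numbers survive. Turns by four and five are turns by two and one with
  -- `b` and `h` exchanged.
  shared-side : ∀ b l h k → side b l ≡ side h k → (b ≡ h × l ≡ k) ⊎ (b ≡ nbr h k × l ≡ r³ k)
  shared-side b l h k = all-turns {P = λ l → side b l ≡ side h k → (b ≡ h × l ≡ k) ⊎ (b ≡ nbr h k × l ≡ r³ k)} k
    (λ e → inj₁ (side-hex-inj b h k e , refl))
    (λ e → ⊥-elim (side-r b h k e))
    (λ e → ⊥-elim (side-r² b h k e))
    (λ e → inj₂ (side-r³ b h k e , refl))
    (λ e → ⊥-elim (side-r² h b (r⁴ k) (trans (cong (side h) (r⁶ k)) (sym e))))
    (λ e → ⊥-elim (side-r h b (r⁵ k) (trans (cong (side h) (r⁶ k)) (sym e))))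
    l

  side-inj : ∀ h {k l} → side h k ≡ side h l → k ≡ l
  side-inj h {k} {l} e with shared-side h k h l e
  ... | inj₁ (_ , p) = p
  ... | inj₂ (p , _) = ⊥-elim (nbr≢ h l (sym p))

  side∈hexEdges : ∀ h k → side h k ∈ hexEdges h
  side∈hexEdges h = all-dirs
    (here refl) (there (here refl)) (there (there (there (there (there (here refl))))))
    (there (there (there (here refl)))) (there (there (here refl))) (there (there (there (there (here refl)))))

  ∈hexEdges⇒side : ∀ h {e} → e ∈ hexEdges h → ∃[ k ] e ≡ side h k
  ∈hexEdges⇒side h (here p)                                 = d0 , p
  ∈hexEdges⇒side h (there (here p))                         = d1 , p
  ∈hexEdges⇒side h (there (there (here p)))                 = d4 , p
  ∈hexEdges⇒side h (there (there (there (here p))))         = d3 , p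
  ∈hexEdges⇒side h (there (there (there (there (here p))))) = d5 , p
  ∈hexEdges⇒side h (there (there (there (there (there (here p)))))) = d2 , p

  vert∈hexVerts : ∀ h k → vert h k ∈ hexVerts h
  vert∈hexVerts h = all-dirs
    (here refl) (there (here refl)) (there (there (here refl)))
    (there (there (there (there (there (here refl)))))) (there (there (there (there (here refl))))) (there (there (there (here refl))))

  ∈hexVerts⇒vert : ∀ h {v} → v ∈ hexVerts h → ∃[ k ] v ≡ vert h k
  ∈hexVerts⇒vert h (here p)                                 = d0 , p
  ∈hexVerts⇒vert h (there (here p))                         = d1 , p
  ∈hexVerts⇒vert h (there (there (here p)))                 = d2 , p
  ∈hexVerts⇒vert h (there (there (there (here p))))         = d5 , p
  ∈hexVerts⇒vert h (there (there (there (there (here p))))) = d4 , p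
  ∈hexVerts⇒vert h (there (there (there (there (there (here p)))))) = d3 , p

  adjacent-nbr : ∀ h k → Adjacent h (nbr h k)
  adjacent-nbr h k = (λ e → nbr≢ h k (sym e)) , side h k , side∈hexEdges h k ,
    subst (_∈ hexEdges (nbr h k)) (side-nbr h k) (side∈hexEdges (nbr h k) (r³ k))

  adjacent⇒nbr : ∀ {h h′} → Adjacent h h′ → ∃[ k ] h′ ≡ nbr h k
  adjacent⇒nbr {h} {h′} (h≢h′ , e , e∈h , e∈h′)
    with ∈hexEdges⇒side h e∈h | ∈hexEdges⇒side h′ e∈h′
  ... | k , p | l , q with shared-side h′ l h k (trans (sym q) p)
  ...   | inj₁ (h′≡h , _) = ⊥-elim (h≢h′ (sym h′≡h))
  ...   | inj₂ (eq , _)   = k , eq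

  adjacent-sym : ∀ {h h′} → Adjacent h h′ → Adjacent h′ h
  adjacent-sym (ne , e , p , q) = (λ eq → ne (sym eq)) , e , q , p

  -- Defs writes the corner after (x + 1 , y) as (x + 1 + 1 , y).
  one+one : ∀ x → x + + 1 + + 1 ≡ x + + 2
  one+one x = ℤ.+-assoc x (+ 1) (+ 1)

  incident : ∀ h k {v} → v ≡ vert h k ⊎ v ≡ vert h (r k) → Incident v (side h k)
  incident h d0 p        = p
  incident h@(i , j) d1 (inj₁ p) = inj₁ p
  incident h@(i , j) d1 (inj₂ p) = inj₂ (trans p (cong (_, j) (sym (one+one (corner h)))))
  incident h d2 p        = p
  incident h@(i , j) d3 (inj₁ p) = inj₂ (trans p (cong (_, j + + 1) (sym (one+one (corner h)))))
  incident h d3 (inj₂ p) = inj₁ p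
  incident h d4 (inj₁ p) = inj₂ p
  incident h d4 (inj₂ p) = inj₁ p
  incident h d5 (inj₁ p) = inj₂ p
  incident h d5 (inj₂ p) = inj₁ p

  incident⁻¹ : ∀ h k {v} → Incident v (side h k) → v ≡ vert h k ⊎ v ≡ vert h (r k)
  incident⁻¹ h d0 p        = p
  incident⁻¹ h@(i , j) d1 (inj₁ p) = inj₁ p
  incident⁻¹ h@(i , j) d1 (inj₂ p) = inj₂ (trans p (cong (_, j) (one+one (corner h))))
  incident⁻¹ h d2 p        = p
  incident⁻¹ h@(i , j) d3 (inj₂ p) = inj₁ (trans p (cong (_, j + + 1) (one+one (corner h))))
  incident⁻¹ h d3 (inj₁ p) = inj₂ p
  incident⁻¹ h d4 (inj₁ p) = inj₂ p
  incident⁻¹ h d4 (inj₂ p) = inj₁ p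
  incident⁻¹ h d5 (inj₁ p) = inj₂ p
  incident⁻¹ h d5 (inj₂ p) = inj₁ p

  -- Both hexagons see the same two ends of the shared edge, but run along it in opposite
  -- directions; the colour decides which end is which.
  vert-nbr : ∀ h k → vert (nbr h k) (r⁴ k) ≡ vert h k
  vert-nbr h k with incident⁻¹ (nbr h k) (r³ k) (subst (Incident (vert h k)) (sym (side-nbr h k)) (incident h k (inj₁ refl)))
  ... | inj₁ e = ⊥-elim (flip k (vert-odd h k (nbr h k) (r³ k) e))
    where
      flip : ∀ k → odd k ≢ odd (r³ k)
      flip = all-dirs (λ ()) (λ ()) (λ ()) (λ ()) (λ ()) (λ ())
  ... | inj₂ e = sym e

  vert-nbr′ : ∀ h k → vert (nbr h k) (r³ k) ≡ vert h (r k)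
  vert-nbr′ h k with incident⁻¹ (nbr h k) (r³ k) (subst (Incident (vert h (r k))) (sym (side-nbr h k)) (incident h k (inj₂ refl)))
  ... | inj₁ e = sym e
  ... | inj₂ e = ⊥-elim (flip k (vert-odd h (r k) (nbr h k) (r⁴ k) e))
    where
      flip : ∀ k → odd (r k) ≢ odd (r⁴ k)
      flip = all-dirs (λ ()) (λ ()) (λ ()) (λ ()) (λ ()) (λ ())

  -- The third lattice edge at corner k, besides the sides r⁵ k and k.
  spoke : Hex → Dir → Edge
  spoke h k = side (nbr h k) (r⁴ k)

  spoke′ : ∀ h k → side (nbr h k) (r² k) ≡ spoke h (r k)
  spoke′ h k = trans (sym (side-nbr (nbr h k) (r² k))) (cong (λ b → side b (r⁵ k)) (nbr-left h k))

  -- Three of the six numbers have the wrong colour, and each of the other three determines the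
  -- hexagon.
  shared-vert : ∀ b l h k → vert b l ≡ vert h (r k) →
                (b ≡ h × l ≡ r k) ⊎ (b ≡ nbr h (r k) × l ≡ r⁵ k) ⊎ (b ≡ nbr h k × l ≡ r³ k)
  shared-vert b l h k = all-turns {P = λ l → vert b l ≡ vert h (r k) →
                (b ≡ h × l ≡ r k) ⊎ (b ≡ nbr h (r k) × l ≡ r⁵ k) ⊎ (b ≡ nbr h k × l ≡ r³ k)} k
    (λ e → ⊥-elim (f₁ k (vert-odd b k h (r k) e)))
    (λ e → inj₁ (vert-hex-inj b h (r k) e , refl))
    (λ e → ⊥-elim (f₂ k (vert-odd b (r² k) h (r k) e)))
    (λ e → inj₂ (inj₂ (vert-hex-inj b (nbr h k) (r³ k) (trans e (sym (vert-nbr′ h k))) , refl)))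
    (λ e → ⊥-elim (f₃ k (vert-odd b (r⁴ k) h (r k) e)))
    (λ e → inj₂ (inj₁ (vert-hex-inj b (nbr h (r k)) (r⁵ k) (trans e (sym (vert-nbr h (r k)))) , refl)))
    l
    where
      f₁ : ∀ k → odd k ≢ odd (r k)
      f₁ = all-dirs (λ ()) (λ ()) (λ ()) (λ ()) (λ ()) (λ ())
      f₂ : ∀ k → odd (r² k) ≢ odd (r k)
      f₂ = all-dirs (λ ()) (λ ()) (λ ()) (λ ()) (λ ()) (λ ())
      f₃ : ∀ k → odd (r⁴ k) ≢ odd (r k)
      f₃ = all-dirs (λ ()) (λ ()) (λ ()) (λ ()) (λ ()) (λ ())

  r-inj : ∀ {k l} → r k ≡ r l → k ≡ l
  r-inj {k} {l} e = trans (sym (r⁶ k)) (trans (cong r⁵ e) (r⁶ l))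

  star : Hex → Dir → List Edge
  star h k = side h k ∷ side h (r k) ∷ spoke h (r k) ∷ []

  star-incident : ∀ h k {e} → e ∈ star h k → Incident (vert h (r k)) e
  star-incident h k (here refl) = incident h k (inj₂ refl)
  star-incident h k (there (here refl)) = incident h (r k) (inj₁ refl)
  star-incident h k (there (there (here refl))) = incident (nbr h (r k)) (r⁵ k) (inj₁ (sym (vert-nbr h (r k))))

  star-complete : ∀ b l h k → Incident (vert h (r k)) (side b l) → side b l ∈ star h k
  star-complete b l h k p = [ (λ e → first (shared-vert b l h k (sym e)))
                            , (λ e → second (shared-vert b (r l) h k (sym e))) ]′ (incident⁻¹ b l p)
    where
      first : (b ≡ h × l ≡ r k) ⊎ (b ≡ nbr h (r k) × l ≡ r⁵ k) ⊎ (b ≡ nbr h k × l ≡ r³ k) → side b l ∈ star h k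
      first (inj₁ (p , q))        = there (here (cong₂ side p q))
      first (inj₂ (inj₁ (p , q))) = there (there (here (cong₂ side p q)))
      first (inj₂ (inj₂ (p , q))) = here (trans (cong₂ side p q) (side-nbr h k))
      second : (b ≡ h × r l ≡ r k) ⊎ (b ≡ nbr h (r k) × r l ≡ r⁵ k) ⊎ (b ≡ nbr h k × r l ≡ r³ k) → side b l ∈ star h k
      second (inj₁ (p , q))        = here (cong₂ side p (r-inj q))
      second (inj₂ (inj₁ (p , q))) = there (here (trans (cong₂ side p (r-inj q)) (side-nbr h (r k))))
      second (inj₂ (inj₂ (p , q))) = there (there (here (trans (cong₂ side p (r-inj q)) (spoke′ h k))))

  _≟H_ : DecidableEquality Hex
  _≟H_ = ≡-dec ℤ._≟_ ℤ._≟_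

  _≟E_ : DecidableEquality Edge
  hor x y ≟E hor x′ y′ = map′ (uncurry (cong₂ hor)) hor-inj (x ℤ.≟ x′ ×-dec y ℤ.≟ y′)
  hor _ _ ≟E ver _ _   = no λ ()
  ver _ _ ≟E hor _ _   = no λ ()
  ver x y ≟E ver x′ y′ = map′ (uncurry (cong₂ ver)) ver-inj (x ℤ.≟ x′ ×-dec y ℤ.≟ y′)

  _≺_ : Hex → Hex → Set
  (i , j) ≺ (i′ , j′) = i <ℤ i′ ⊎ (i ≡ i′ × j <ℤ j′)

  ≺-trans : ∀ {a b c} → a ≺ b → b ≺ c → a ≺ c
  ≺-trans (inj₁ p)          (inj₁ q)          = inj₁ (ℤ.<-trans p q)
  ≺-trans (inj₁ p)          (inj₂ (refl , _)) = inj₁ p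
  ≺-trans (inj₂ (refl , _)) (inj₁ q)          = inj₁ q
  ≺-trans (inj₂ (refl , p)) (inj₂ (refl , q)) = inj₂ (refl , ℤ.<-trans p q)

  ≺-irrefl : ∀ {a} → ¬ a ≺ a
  ≺-irrefl (inj₁ p)       = ℤ.<-irrefl refl p
  ≺-irrefl (inj₂ (_ , p)) = ℤ.<-irrefl refl p

  _≺?_ : ∀ a b → Dec (a ≺ b)
  (i , j) ≺? (i′ , j′) = (i ℤ.<? i′) ⊎-dec ((i ℤ.≟ i′) ×-dec (j ℤ.<? j′))

  largest : ∀ x xs → ∃[ m ] (m ∈ x ∷ xs × (∀ {y} → y ∈ x ∷ xs → ¬ m ≺ y))
  largest x [] = x , here refl , λ { (here refl) → ≺-irrefl }
  largest x (y ∷ xs) with largest y xs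
  ... | m , m∈ , max with m ≺? x
  ...   | yes m≺x = x , here refl , λ { (here refl) → ≺-irrefl ; (there z∈) x≺z → max z∈ (≺-trans m≺x x≺z) }
  ...   | no ¬m≺x = m , there m∈ , λ { (here refl) → ¬m≺x ; (there z∈) → max z∈ }

  i<i+1 : ∀ i → i <ℤ i + + 1
  i<i+1 i = ℤ.suc[i]≤j⇒i<j (ℤ.≤-reflexive (ℤ.+-comm (+ 1) i))

  -- These three neighbours are consecutive around h, so a lexicographically maximal h can be
  -- the root.
  ≺-nbr₁ : ∀ h → h ≺ nbr h d1
  ≺-nbr₁ (i , j) = inj₁ (i<i+1 i)

  ≺-nbr₂ : ∀ h → h ≺ nbr h d2
  ≺-nbr₂ (i , j) = inj₁ (i<i+1 i)

  ≺-nbr₃ : ∀ h → h ≺ nbr h d3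
  ≺-nbr₃ (i , j) = inj₂ (sym (ℤ.+-identityʳ i) , i<i+1 j)

open Honeycomb
open import Data.Nat using (ℕ; zero; suc; _+_; _⊓_; _≤_; z≤n; s≤s; _≤?_)
open import Data.Nat.Properties
open import Data.Nat.Tactic.RingSolver using (solve-∀)

-- Matchings and cuts of rooted trees

-- The inner dual, rooted at a side of a hexagon: with the root side numbered 0, the
-- hexagon has either one branch behind side 3 (lin) or branches behind sides 2 and 4
-- (fork). The empty branch nil still has its root edge, which is part of the parent.
data Shape : Set where
  nil  : Shape
  lin  : Shape → Shape
  fork : Shape → Shape → Shape

-- Labellings of the edges other than the root edge.
data Lab (A : Set) : Shape → Set where
  nil  : Lab A nil
  lin  : ∀ {B} (e₁ e₂ e₃ e₄ e₅ : A) → Lab A B → Lab A (lin B)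
  fork : ∀ {B C} (e₁ e₂ e₃ e₄ e₅ : A) → Lab A B → Lab A C → Lab A (fork B C)

-- The perfect matchings of a branch, by what they do at the two ends of its root edge:
-- M0 leaves both ends uncovered, M1 covers both without the root edge, and MC is a
-- perfect matching of the branch with its root edge added.
mutual
  data M0 : Shape → Set where
    nil  : M0 nil
    lin  : ∀ {B} → M0 B → M0 (lin B)
    fork : ∀ {B C} → MC B → MC C → M0 (fork B C)

  data M1 : Shape → Set where
    lin  : ∀ {B} → MC B → M1 (lin B)
    fork : ∀ {B C} → M0 B → M0 C → M1 (fork B C)

  data MC (B : Shape) : Set where
    incl : M0 B → MC B
    excl : M1 B → MC B

-- a0 m and a1 q are the least numbers of edges to cut so that m is the only matching of
-- its kind M0 or M1 left; for b0 m and b1 q no matching of the other kind may be left.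
-- cv x makes x unique in MC, where the root edge may be cut too; for dv x moreover
-- either no M0 is left or one extra cut is paid, to be made in the parent hexagon.
mutual
  a0 b0 : ∀ {T} → M0 T → ℕ
  a0 nil        = 0
  a0 (lin m)    = a0 m
  a0 (fork x y) = cv x + cv y
  b0 nil        = 0
  b0 (lin m)    = suc (a0 m)
  b0 (fork x y) = (dv x + cv y) ⊓ (cv x + dv y)

  a1 b1 : ∀ {T} → M1 T → ℕ
  a1 (lin x)    = cv x
  a1 (fork m n) = a0 m + a0 n
  b1 (lin x)    = dv x
  b1 (fork m n) = suc ((b0 m + a0 n) ⊓ (a0 m + b0 n))

  cv dv : ∀ {T} → MC T → ℕ
  cv (incl m) = b0 m
  cv (excl q)  = suc (a1 q) ⊓ b1 q
  dv (incl m) = suc (b0 m)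
  dv (excl q)  = b1 q

mutual
  a0≤b0 : ∀ {T} (m : M0 T) → a0 m ≤ b0 m
  a0≤b0 nil        = z≤n
  a0≤b0 (lin m)    = n≤1+n _
  a0≤b0 (fork x y) = ⊓-glb (+-monoˡ-≤ _ (cv≤dv x)) (+-monoʳ-≤ (cv x) (cv≤dv y))

  b0≤1+a0 : ∀ {T} (m : M0 T) → b0 m ≤ suc (a0 m)
  b0≤1+a0 nil        = z≤n
  b0≤1+a0 (lin m)    = ≤-refl
  b0≤1+a0 (fork x y) = ≤-trans (m⊓n≤m _ _) (+-monoˡ-≤ (cv y) (dv≤1+cv x))

  -- Cutting the root edge and also paying the extra cut would cost `2 + a1 q`. By this bound that
  -- never beats `b1 q`, which is why `dv (excl q)` needs no minimum.
  b1≤2+a1 : ∀ {T} (q : M1 T) → b1 q ≤ suc (suc (a1 q))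
  b1≤2+a1 (lin x)    = ≤-trans (dv≤1+cv x) (n≤1+n _)
  b1≤2+a1 (fork m n) = s≤s (≤-trans (m⊓n≤m _ _) (+-monoˡ-≤ (a0 n) (b0≤1+a0 m)))

  cv≤dv : ∀ {T} (x : MC T) → cv x ≤ dv x
  cv≤dv (incl m) = n≤1+n _
  cv≤dv (excl q)  = m⊓n≤n _ _

  dv≤1+cv : ∀ {T} (x : MC T) → dv x ≤ suc (cv x)
  dv≤1+cv (incl m) = ≤-refl
  dv≤1+cv (excl q)  = ⊓-glb (b1≤2+a1 q) (n≤1+n _)

-- Cuts and the matchings that survive them

bit : Bool → ℕ
bit true  = 1
bit false = 0

bits : Bool → Bool → Bool → Bool → Bool → ℕ
bits s₁ s₂ s₃ s₄ s₅ = bit s₁ + (bit s₂ + (bit s₃ + (bit s₄ + bit s₅)))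

sz : ∀ {T} → Lab Bool T → ℕ
sz nil                           = 0
sz (lin s₁ s₂ s₃ s₄ s₅ s)        = bits s₁ s₂ s₃ s₄ s₅ + sz s
sz (fork s₁ s₂ s₃ s₄ s₅ s t)     = bits s₁ s₂ s₃ s₄ s₅ + (sz s + sz t)

mutual
  Dis0 : ∀ {T} → M0 T → Lab Bool T → Set
  Dis0 nil nil = ⊤
  Dis0 (lin m) (lin s₁ s₂ s₃ s₄ s₅ s) = s₂ ≡ false × s₄ ≡ false × Dis0 m s
  Dis0 (fork x y) (fork s₁ s₂ s₃ s₄ s₅ s t) = DisC x s₂ s × DisC y s₄ t

  Dis1 : ∀ {T} → M1 T → Lab Bool T → Set
  Dis1 (lin x) (lin s₁ s₂ s₃ s₄ s₅ s) = s₁ ≡ false × s₅ ≡ false × DisC x s₃ s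
  Dis1 (fork m n) (fork s₁ s₂ s₃ s₄ s₅ s t) =
    s₁ ≡ false × s₃ ≡ false × s₅ ≡ false × Dis0 m s × Dis0 n t

  DisC : ∀ {T} → MC T → Bool → Lab Bool T → Set
  DisC (incl m) r s = r ≡ false × Dis0 m s
  DisC (excl q)  r s = Dis1 q s

Emp0 Emp1 : ∀ {T} → Lab Bool T → Set
Emp0 s = ∀ m → ¬ Dis0 m s
Emp1 s = ∀ q → ¬ Dis1 q s

Unq0 : ∀ {T} → M0 T → Lab Bool T → Set
Unq0 m s = Dis0 m s × (∀ m′ → Dis0 m′ s → m′ ≡ m)

Unq1 : ∀ {T} → M1 T → Lab Bool T → Set
Unq1 q s = Dis1 q s × (∀ q′ → Dis1 q′ s → q′ ≡ q)

UnqC : ∀ {T} → MC T → Bool → Lab Bool T → Set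
UnqC x r s = DisC x r s × (∀ x′ → DisC x′ r s → x′ ≡ x)

mutual
  -- The lower bounds split on whether a matching of a given kind survives in a branch, so this has
  -- to be decided.
  find0 : ∀ {T} (s : Lab Bool T) → (∃[ m ] Dis0 m s) ⊎ Emp0 s
  find0 nil = inj₁ (nil , tt)
  find0 (lin s₁ true s₃ s₄ s₅ s) = inj₂ λ { (lin m) (() , _) }
  find0 (lin s₁ false s₃ true s₅ s) = inj₂ λ { (lin m) (_ , () , _) }
  find0 (lin s₁ false s₃ false s₅ s) with find0 s
  ... | inj₁ (m , p) = inj₁ (lin m , refl , refl , p)
  ... | inj₂ e       = inj₂ λ { (lin m) (_ , _ , p) → e m p }
  find0 (fork s₁ s₂ s₃ s₄ s₅ s t) with findC s₂ s | findC s₄ t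
  ... | inj₁ (x , p) | inj₁ (y , q) = inj₁ (fork x y , p , q)
  ... | inj₁ _       | inj₂ e       = inj₂ λ { (fork x y) (_ , q) → e y q }
  ... | inj₂ e       | _            = inj₂ λ { (fork x y) (p , _) → e x p }

  find1 : ∀ {T} (s : Lab Bool T) → (∃[ q ] Dis1 q s) ⊎ Emp1 s
  find1 nil = inj₂ λ ()
  find1 (lin true s₂ s₃ s₄ s₅ s) = inj₂ λ { (lin x) (() , _) }
  find1 (lin false s₂ s₃ s₄ true s) = inj₂ λ { (lin x) (_ , () , _) }
  find1 (lin false s₂ s₃ s₄ false s) with findC s₃ s
  ... | inj₁ (x , p) = inj₁ (lin x , refl , refl , p)
  ... | inj₂ e       = inj₂ λ { (lin x) (_ , _ , p) → e x p }
  find1 (fork true s₂ s₃ s₄ s₅ s t) = inj₂ λ { (fork m n) (() , _) }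
  find1 (fork false s₂ true s₄ s₅ s t) = inj₂ λ { (fork m n) (_ , () , _) }
  find1 (fork false s₂ false s₄ true s t) = inj₂ λ { (fork m n) (_ , _ , () , _) }
  find1 (fork false s₂ false s₄ false s t) with find0 s | find0 t
  ... | inj₁ (m , p) | inj₁ (n , q) = inj₁ (fork m n , refl , refl , refl , p , q)
  ... | inj₁ _       | inj₂ e       = inj₂ λ { (fork m n) (_ , _ , _ , _ , q) → e n q }
  ... | inj₂ e       | _            = inj₂ λ { (fork m n) (_ , _ , _ , p , _) → e m p }

  findC : ∀ {T} (r : Bool) (s : Lab Bool T) →
          (∃[ x ] DisC x r s) ⊎ (∀ x → ¬ DisC x r s)
  findC r s with find1 s
  findC r s     | inj₁ (q , p) = inj₁ (excl q , p)
  findC true s  | inj₂ e = inj₂ λ { (incl m) (() , _) ; (excl q) p → e q p }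
  findC false s | inj₂ e with find0 s
  ... | inj₁ (m , p) = inj₁ (incl m , refl , p)
  ... | inj₂ e′      = inj₂ λ { (incl m) (_ , p) → e′ m p ; (excl q) p → e q p }

-- Every isolating cut is at least as large as the recursive value

lin0-inj : ∀ {B} {m n : M0 B} → M0.lin m ≡ lin n → m ≡ n
lin0-inj refl = refl
lin1-inj : ∀ {B} {x y : MC B} → M1.lin x ≡ lin y → x ≡ y
lin1-inj refl = refl
fork0-inj : ∀ {B C} {x x′ : MC B} {y y′ : MC C} → M0.fork x y ≡ fork x′ y′ → x ≡ x′ × y ≡ y′
fork0-inj refl = refl , refl
fork1-inj : ∀ {B C} {x x′ : M0 B} {y y′ : M0 C} → M1.fork x y ≡ fork x′ y′ → x ≡ x′ × y ≡ y′
fork1-inj refl = refl , refl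
incl-inj : ∀ {B} {m n : M0 B} → incl m ≡ incl n → m ≡ n
incl-inj refl = refl
excl-inj : ∀ {B} {m n : M1 B} → MC.excl m ≡ excl n → m ≡ n
excl-inj refl = refl

bits-even : ∀ s₁ s₂ s₃ s₄ s₅ → bit s₂ + bit s₄ ≤ bits s₁ s₂ s₃ s₄ s₅
bits-even s₁ s₂ s₃ s₄ s₅ =
  ≤-trans (+-monoʳ-≤ (bit s₂) (≤-trans (m≤m+n _ _) (m≤n+m _ (bit s₃)))) (m≤n+m _ (bit s₁))

bits-mid : ∀ s₁ s₂ s₃ s₄ s₅ → bit s₂ + (bit s₃ + bit s₄) ≤ bits s₁ s₂ s₃ s₄ s₅
bits-mid s₁ s₂ s₃ s₄ s₅ =
  ≤-trans (+-monoʳ-≤ (bit s₂) (+-monoʳ-≤ (bit s₃) (m≤m+n _ _))) (m≤n+m _ (bit s₁))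

bits-odd : ∀ s₁ s₂ s₃ s₄ s₅ → bits s₁ s₂ s₃ s₄ s₅ ≡ (bit s₁ + (bit s₃ + bit s₅)) + (bit s₂ + bit s₄)
bits-odd s₁ s₂ s₃ s₄ s₅ = trans (cong (bit s₁ +_) (go (bit s₂) (bit s₃) (bit s₄) (bit s₅))) (sym (+-assoc (bit s₁) _ _))
  where
    go : ∀ a b c d → a + (b + (c + d)) ≡ (b + d) + (a + c)
    go = solve-∀

-- Inside the hexagon, the `M1` to be excluded for `b0` uses sides 1, 3 and 5 only. If one of these
-- is cut, it comes on top of the cuts at 2 and 4, which are the root edges of the branches of a
-- fork and are already charged to them.
odd-cut : ∀ s₁ s₂ s₃ s₄ s₅ →
          (s₁ ≡ false × s₃ ≡ false × s₅ ≡ false) ⊎ suc (bit s₂ + bit s₄) ≤ bits s₁ s₂ s₃ s₄ s₅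
odd-cut false s₂ false s₄ false = inj₁ (refl , refl , refl)
odd-cut true  s₂ s₃ s₄ s₅ = inj₂ (s≤s (bits-even false s₂ s₃ s₄ s₅))
odd-cut false s₂ true s₄ s₅ rewrite bits-odd false s₂ true s₄ s₅ = inj₂ (s≤s (m≤n+m _ (bit s₅)))
odd-cut false s₂ false s₄ true rewrite bits-odd false s₂ false s₄ true = inj₂ ≤-refl

-- The counterpart for a `lin`: sides 2 and 4 block its `M0`, while side 3 is the root edge of the
-- branch, already charged to it.
even-cut : ∀ s₁ s₂ s₃ s₄ s₅ →
           (s₂ ≡ false × s₄ ≡ false) ⊎ suc (bit s₃) ≤ bits s₁ s₂ s₃ s₄ s₅
even-cut s₁ false s₃ false s₅ = inj₁ (refl , refl)
even-cut s₁ true s₃ s₄ s₅ =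
  inj₂ (≤-trans (s≤s (m≤m+n (bit s₃) (bit s₄))) (bits-mid s₁ true s₃ s₄ s₅))
even-cut s₁ false s₃ true s₅ =
  inj₂ (≤-trans (≤-reflexive (+-comm 1 (bit s₃))) (bits-mid s₁ false s₃ true s₅))

regroup : ∀ a b c d → (a + b) + (c + d) ≡ (a + c) + (b + d)
regroup = solve-∀

fork-unqˡ : ∀ {B C} (x : MC B) (y : MC C) {s₁ s₂ s₃ s₄ s₅ s t} →
            Unq0 (fork x y) (fork s₁ s₂ s₃ s₄ s₅ s t) → UnqC x s₂ s
fork-unqˡ x y ((p , q) , u) = p , λ x′ p′ → proj₁ (fork0-inj (u (fork x′ y) (p′ , q)))

fork-unqʳ : ∀ {B C} (x : MC B) (y : MC C) {s₁ s₂ s₃ s₄ s₅ s t} →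
            Unq0 (fork x y) (fork s₁ s₂ s₃ s₄ s₅ s t) → UnqC y s₄ t
fork-unqʳ x y ((p , q) , u) = q , λ y′ q′ → proj₂ (fork0-inj (u (fork x y′) (p , q′)))

lin1-unq : ∀ {B} {x : MC B} {s₁ s₂ s₃ s₄ s₅ s} →
           Unq1 (lin x) (lin s₁ s₂ s₃ s₄ s₅ s) → UnqC x s₃ s
lin1-unq ((p₁ , p₅ , p) , u) = p , λ x′ p′ → lin1-inj (u (lin x′) (p₁ , p₅ , p′))

fork1-unqˡ : ∀ {B C} {m : M0 B} {n : M0 C} {s₁ s₂ s₃ s₄ s₅ s t} →
             Unq1 (fork m n) (fork s₁ s₂ s₃ s₄ s₅ s t) → Unq0 m s
fork1-unqˡ ((p₁ , p₃ , p₅ , p , q) , u) =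
  p , λ m′ p′ → proj₁ (fork1-inj (u (fork m′ _) (p₁ , p₃ , p₅ , p′ , q)))

fork1-unqʳ : ∀ {B C} {m : M0 B} {n : M0 C} {s₁ s₂ s₃ s₄ s₅ s t} →
             Unq1 (fork m n) (fork s₁ s₂ s₃ s₄ s₅ s t) → Unq0 n t
fork1-unqʳ ((p₁ , p₃ , p₅ , p , q) , u) =
  q , λ n′ q′ → proj₂ (fork1-inj (u (fork _ n′) (p₁ , p₃ , p₅ , p , q′)))

excl-unq : ∀ {T} {q : M1 T} {r s} → UnqC (excl q) r s → Unq1 q s
excl-unq (p , u) = p , λ q′ p′ → excl-inj (u (excl q′) p′)

mutual
  lb-a0 : ∀ {T} (m : M0 T) s → Unq0 m s → a0 m ≤ sz s
  lb-a0 nil s u = z≤n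
  lb-a0 (lin m) (lin s₁ s₂ s₃ s₄ s₅ s) ((p₂ , p₄ , p) , u) =
    ≤-trans (lb-a0 m s (p , λ m′ p′ → lin0-inj (u (lin m′) (p₂ , p₄ , p′)))) (m≤n+m _ _)
  lb-a0 (fork x y) (fork s₁ s₂ s₃ s₄ s₅ s t) u =
    ≤-trans (lb-c² x y s₂ s₄ s t u) (+-monoˡ-≤ _ (bits-even s₁ s₂ s₃ s₄ s₅))

  lb-c² : ∀ {B C} (x : MC B) (y : MC C) {s₁ s₃ s₅} s₂ s₄ s t →
          Unq0 (fork x y) (fork s₁ s₂ s₃ s₄ s₅ s t) →
          cv x + cv y ≤ (bit s₂ + bit s₄) + (sz s + sz t)
  lb-c² x y s₂ s₄ s t u =
    ≤-trans (+-mono-≤ (lb-c x s₂ s (fork-unqˡ x y u)) (lb-c y s₄ t (fork-unqʳ x y u)))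
            (≤-reflexive (regroup (bit s₂) (sz s) (bit s₄) (sz t)))

  -- In a `lin`, free odd sides would let the hexagon be rotated into a surviving `M1`, so one cut
  -- lies there. In a fork, either an odd side is cut, and that cut pays for passing from `cv` to
  -- `dv` in one branch, or one of the branches has lost all its `M0`; the choice of the branch
  -- gives the two terms of the minimum.
  lb-b0 : ∀ {T} (m : M0 T) s → Unq0 m s → Emp1 s → b0 m ≤ sz s
  lb-b0 nil s u e = z≤n
  lb-b0 (lin m) (lin s₁ s₂ s₃ s₄ s₅ s) ((p₂ , p₄ , p) , u) e with odd-cut s₁ s₂ s₃ s₄ s₅
  ... | inj₁ (p₁ , p₃ , p₅) = ⊥-elim (e (lin (incl m)) (p₁ , p₅ , p₃ , p))
  ... | inj₂ h = +-mono-≤ (≤-trans (s≤s z≤n) h)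
                   (lb-a0 m s (p , λ m′ p′ → lin0-inj (u (lin m′) (p₂ , p₄ , p′))))
  lb-b0 (fork x y) (fork s₁ s₂ s₃ s₄ s₅ s t) u e with odd-cut s₁ s₂ s₃ s₄ s₅
  ... | inj₂ h = ≤-trans (m⊓n≤m _ _) (≤-trans (+-monoˡ-≤ (cv y) (dv≤1+cv x))
                   (≤-trans (s≤s (lb-c² x y s₂ s₄ s t u)) (+-monoˡ-≤ _ h)))
  ... | inj₁ (p₁ , p₃ , p₅) with find0 s | find0 t
  ...   | inj₁ (m , p) | inj₁ (n , q) = ⊥-elim (e (fork m n) (p₁ , p₃ , p₅ , p , q))
  ...   | inj₂ e′ | _ =
    ≤-trans (m⊓n≤m _ _)
      (≤-trans (+-mono-≤ (lb-d x s₂ s (fork-unqˡ x y u) e′) (lb-c y s₄ t (fork-unqʳ x y u)))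
      (≤-trans (≤-reflexive (regroup (bit s₂) (sz s) (bit s₄) (sz t)))
               (+-monoˡ-≤ _ (bits-even s₁ s₂ s₃ s₄ s₅))))
  ...   | inj₁ _ | inj₂ e′ =
    ≤-trans (m⊓n≤n _ _)
      (≤-trans (+-mono-≤ (lb-c x s₂ s (fork-unqˡ x y u)) (lb-d y s₄ t (fork-unqʳ x y u) e′))
      (≤-trans (≤-reflexive (regroup (bit s₂) (sz s) (bit s₄) (sz t)))
               (+-monoˡ-≤ _ (bits-even s₁ s₂ s₃ s₄ s₅))))

  lb-a1 : ∀ {T} (q : M1 T) s → Unq1 q s → a1 q ≤ sz s
  lb-a1 (lin x) (lin s₁ s₂ s₃ s₄ s₅ s) u =
    ≤-trans (lb-c x s₃ s (lin1-unq u))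
      (+-monoˡ-≤ _ (≤-trans (≤-trans (m≤m+n _ (bit s₄)) (m≤n+m _ (bit s₂))) (bits-mid s₁ s₂ s₃ s₄ s₅)))
  lb-a1 (fork m n) (fork s₁ s₂ s₃ s₄ s₅ s t) u =
    ≤-trans (+-mono-≤ (lb-a0 m s (fork1-unqˡ u)) (lb-a0 n t (fork1-unqʳ u))) (m≤n+m _ (bits s₁ s₂ s₃ s₄ s₅))

  -- A fork loses its `M0` only if one branch has no member of `MC` left. As that branch still has a
  -- surviving `M0`, its root edge must be cut and its `M1` destroyed: the cut is the `suc`, the
  -- destruction turns `a0` into `b0`.
  lb-b1 : ∀ {T} (q : M1 T) s → Unq1 q s → Emp0 s → b1 q ≤ sz s
  lb-b1 (lin x) (lin s₁ s₂ s₃ s₄ s₅ s) u e with even-cut s₁ s₂ s₃ s₄ s₅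
  ... | inj₂ h = ≤-trans (dv≤1+cv x) (≤-trans (s≤s (lb-c x s₃ s (lin1-unq u))) (+-monoˡ-≤ _ h))
  ... | inj₁ (p₂ , p₄) =
    ≤-trans (lb-d x s₃ s (lin1-unq u) λ m p → e (lin m) (p₂ , p₄ , p))
      (+-monoˡ-≤ _ (≤-trans (≤-trans (m≤m+n _ (bit s₄)) (m≤n+m _ (bit s₂))) (bits-mid s₁ s₂ s₃ s₄ s₅)))
  lb-b1 (fork m n) (fork s₁ s₂ s₃ s₄ s₅ s t) u e with blocked s₂ s m | blocked s₄ t n
    where
      blocked : ∀ {B} r (s : Lab Bool B) (m : M0 B) → Dis0 m s →
                (∃[ x ] DisC x r s) ⊎ (r ≡ true × Emp1 s)
      blocked false s m p = inj₁ (incl m , refl , p)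
      blocked true  s m p with find1 s
      ... | inj₁ (q , p′) = inj₁ (excl q , p′)
      ... | inj₂ e        = inj₂ (refl , e)
  ... | f | g with f (proj₁ (fork1-unqˡ u)) | g (proj₁ (fork1-unqʳ u))
  ...   | inj₁ (x , p) | inj₁ (y , q) = ⊥-elim (e (fork x y) (p , q))
  ...   | inj₂ (refl , e′) | _ =
    ≤-trans (s≤s (m⊓n≤m _ _))
      (≤-trans (s≤s (+-mono-≤ (lb-b0 m s (fork1-unqˡ u) e′) (lb-a0 n t (fork1-unqʳ u))))
               (+-monoˡ-≤ _ (≤-trans (s≤s z≤n) (bits-even s₁ true s₃ s₄ s₅))))
  ...   | inj₁ _ | inj₂ (refl , e′) =
    ≤-trans (s≤s (m⊓n≤n (b0 m + a0 n) _))
      (≤-trans (s≤s (+-mono-≤ (lb-a0 m s (fork1-unqˡ u)) (lb-b0 n t (fork1-unqʳ u) e′)))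
               (+-monoˡ-≤ _ (≤-trans (m≤n+m 1 (bit s₂)) (bits-even s₁ s₂ s₃ true s₅))))

  -- For `excl q`, a cut root edge pays for the `suc` of the first term. If it is uncut, any
  -- surviving `M0` would be a second member of `MC`, so none survives and the second term applies.
  lb-c : ∀ {T} (x : MC T) r s → UnqC x r s → cv x ≤ bit r + sz s
  lb-c (incl m) r s ((pr , p) , u) =
    ≤-trans (lb-b0 m s (p , λ m′ p′ → incl-inj (u (incl m′) (pr , p′)))
                       (λ q p′ → case u (excl q) p′ of λ ()))
            (m≤n+m _ _)
  lb-c (excl q) true  s u = ≤-trans (m⊓n≤m _ _) (s≤s (lb-a1 q s (excl-unq u)))
  lb-c (excl q) false s u =
    ≤-trans (m⊓n≤n (suc (a1 q)) _)
      (lb-b1 q s (excl-unq u) λ m p → case proj₂ u (incl m) (refl , p) of λ ())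

  lb-d : ∀ {T} (x : MC T) r s → UnqC x r s → Emp0 s → dv x ≤ bit r + sz s
  lb-d (incl m) r s ((_ , p) , u) e = ⊥-elim (e m p)
  lb-d (excl q)  r s u e = ≤-trans (lb-b1 q s (excl-unq u) e) (m≤n+m _ _)

-- Cuts that attain the recursive values

clash : ∀ {z} → z ≡ true → z ≡ false → ⊥
clash refl ()

unq-lin0 : ∀ {B} {m : M0 B} {s₁ s₃ s₅ s} → Unq0 m s → Unq0 (lin m) (lin s₁ false s₃ false s₅ s)
unq-lin0 (p , u) = (refl , refl , p) , λ { (lin m) (_ , _ , p′) → cong lin (u m p′) }

unq-fork0 : ∀ {B C} {x : MC B} {y : MC C} {s₁ s₂ s₃ s₄ s₅ s t} →
            UnqC x s₂ s → UnqC y s₄ t → Unq0 (fork x y) (fork s₁ s₂ s₃ s₄ s₅ s t)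
unq-fork0 (p , u) (q , v) =
  (p , q) , λ { (fork x y) (p′ , q′) → cong₂ fork (u x p′) (v y q′) }

unq-lin1 : ∀ {B} {x : MC B} {s₂ s₃ s₄ s} → UnqC x s₃ s → Unq1 (lin x) (lin false s₂ s₃ s₄ false s)
unq-lin1 (p , u) = (refl , refl , p) , λ { (lin x) (_ , _ , p′) → cong lin (u x p′) }

unq-fork1 : ∀ {B C} {m : M0 B} {n : M0 C} {s₂ s₄ s t} →
            Unq0 m s → Unq0 n t → Unq1 (fork m n) (fork false s₂ false s₄ false s t)
unq-fork1 (p , u) (q , v) = (refl , refl , refl , p , q) ,
  λ { (fork m n) (_ , _ , _ , p′ , q′) → cong₂ fork (u m p′) (v n q′) }

unq-incl : ∀ {B} {m : M0 B} {s} → Unq0 m s → Emp1 s → UnqC (incl m) false s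
unq-incl (p , u) e = (refl , p) , λ
  { (incl m) (_ , p′) → cong incl (u m p′)
  ; (excl q) p′ → ⊥-elim (e q p′) }

unq-excl : ∀ {B} {q : M1 B} {r s} → Unq1 q s → (r ≡ true ⊎ Emp0 s) → UnqC (excl q) r s
unq-excl (p , u) e = p , λ
  { (incl m) (refl , p′) → case e of λ { (inj₁ ()) ; (inj₂ e′) → ⊥-elim (e′ m p′) }
  ; (excl q) p′ → cong excl (u q p′) }

mutual
  ub-a0 : ∀ {T} (m : M0 T) → ∃[ s ] (Unq0 m s × sz s ≤ a0 m)
  ub-a0 nil = nil , (tt , λ { nil _ → refl }) , z≤n
  ub-a0 (lin m) =
    let s , u , h = ub-a0 m in lin false false false false false s , unq-lin0 u , h
  ub-a0 (fork x y) =
    let r , s , u , h = ub-c x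
        r′ , t , v , k = ub-c y
    in fork false r false r′ false s t , unq-fork0 u v , merge r r′ h k

  merge : ∀ r r′ {i j k l} → bit r + i ≤ k → bit r′ + j ≤ l →
          (bit r + (bit r′ + 0)) + (i + j) ≤ k + l
  merge r r′ {i} {j} h k rewrite +-identityʳ (bit r′) =
    ≤-trans (≤-reflexive (regroup (bit r) (bit r′) i j)) (+-mono-≤ h k)

  -- Here `z` is the extra cut, laid on side 1 of the parent hexagon but charged to the branch whose
  -- `dv` is spent: the first branch here, the second in `merge-z′`.
  merge-z : ∀ z r r′ {i j k l} → bit z + (bit r + i) ≤ k → bit r′ + j ≤ l →
            (bit z + (bit r + (bit r′ + 0))) + (i + j) ≤ k + l
  merge-z false r r′ h k = merge r r′ h k
  merge-z true  r r′ {i} {j} {suc n} (s≤s h) k = s≤s (merge r r′ h k)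

  merge-z′ : ∀ z r r′ {i j k l} → bit r + i ≤ k → bit z + (bit r′ + j) ≤ l →
             (bit z + (bit r + (bit r′ + 0))) + (i + j) ≤ k + l
  merge-z′ false r r′ h k = merge r r′ h k
  merge-z′ true  r r′ {i} {j} {n} {suc l} h (s≤s k) rewrite +-suc n l = s≤s (merge r r′ h k)

  ub-b0 : ∀ {T} (m : M0 T) → ∃[ s ] (Unq0 m s × Emp1 s × sz s ≤ b0 m)
  ub-b0 nil = nil , (tt , λ { nil _ → refl }) , (λ ()) , z≤n
  ub-b0 (lin m) =
    let s , u , h = ub-a0 m
    -- Side 1 lies in every `M1` of a `lin` and in none of its `M0`.
    in lin true false false false false s , unq-lin0 u , (λ { (lin x) (() , _) }) , s≤s h
  ub-b0 (fork x y) with ⊓-sel (dv x + cv y) (cv x + dv y)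
  ... | inj₁ eq rewrite eq =
    let z , r , s , u , e , h = ub-d x
        r′ , t , v , k = ub-c y
    in fork z r false r′ false s t , unq-fork0 u v
     , (λ { (fork m n) (z≡f , _ , _ , p , q) → case e of λ { (inj₁ z≡t) → clash z≡t z≡f ; (inj₂ e′) → e′ m p } })
     , merge-z z r r′ h k
  ... | inj₂ eq rewrite eq =
    let r , s , u , h = ub-c x
        z , r′ , t , v , e , k = ub-d y
    in fork z r false r′ false s t , unq-fork0 u v
     , (λ { (fork m n) (z≡f , _ , _ , p , q) → case e of λ { (inj₁ z≡t) → clash z≡t z≡f ; (inj₂ e′) → e′ n q } })
     , merge-z′ z r r′ h k

  ub-a1 : ∀ {T} (q : M1 T) → ∃[ s ] (Unq1 q s × sz s ≤ a1 q)
  ub-a1 (lin x) =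
    let r , s , u , h = ub-c x
    in lin false false r false false s , unq-lin1 u
     , ≤-trans (≤-reflexive (cong (_+ sz s) (+-identityʳ (bit r)))) h
  ub-a1 (fork m n) =
    let s , u , h = ub-a0 m
        t , v , k = ub-a0 n
    in fork false false false false false s t , unq-fork1 u v , +-mono-≤ h k

  ub-b1 : ∀ {T} (q : M1 T) → ∃[ s ] (Unq1 q s × Emp0 s × sz s ≤ b1 q)
  ub-b1 (lin x) =
    let z , r , s , u , e , h = ub-d x
    -- The extra cut goes on side 2, which every `M0` of a `lin` uses and no `M1` does.
    in lin false z r false false s , unq-lin1 u
     , (λ { (lin m) (z≡f , _ , p) → case e of λ { (inj₁ z≡t) → clash z≡t z≡f ; (inj₂ e′) → e′ m p } })
     , ≤-trans (≤-reflexive (trans (cong (λ k → bit z + k + sz s) (+-identityʳ (bit r)))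
                                   (+-assoc (bit z) (bit r) (sz s)))) h
  ub-b1 (fork m n) with ⊓-sel (b0 m + a0 n) (a0 m + b0 n)
  ... | inj₁ eq rewrite eq =
    let s , u , e , h = ub-b0 m
        t , v , k = ub-a0 n
    -- Without its root edge the first branch could be completed only by an `M1`, and `s` destroys
    -- those; hence no `M0` of the fork is left.
    in fork false true false false false s t , unq-fork1 u v
     , (λ { (fork (incl _) y) ((() , _) , _) ; (fork (excl q) y) (p , _) → e q p })
     , s≤s (+-mono-≤ h k)
  ... | inj₂ eq rewrite eq =
    let s , u , h = ub-a0 m
        t , v , e , k = ub-b0 n
    in fork false false false true false s t , unq-fork1 u v
     , (λ { (fork x (incl _)) (_ , (() , _)) ; (fork x (excl q)) (_ , p) → e q p })
     , s≤s (+-mono-≤ h k)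

  ub-c : ∀ {T} (x : MC T) → ∃[ r ] ∃[ s ] (UnqC x r s × bit r + sz s ≤ cv x)
  ub-c (incl m) =
    let s , u , e , h = ub-b0 m in false , s , unq-incl u e , h
  ub-c (excl q) with ⊓-sel (suc (a1 q)) (b1 q)
  ... | inj₁ eq rewrite eq = let s , u , h = ub-a1 q in true , s , unq-excl u (inj₁ refl) , s≤s h
  ... | inj₂ eq rewrite eq = let s , u , e , h = ub-b1 q in false , s , unq-excl u (inj₂ e) , h

  -- The bit `z` says whether the extra cut is paid. For `incl m` it must be, since `m` itself is a
  -- surviving `M0`; for `excl q` the cut for `b1 q` already removes every `M0`.
  ub-d : ∀ {T} (x : MC T) → ∃[ z ] ∃[ r ] ∃[ s ]
         (UnqC x r s × (z ≡ true ⊎ Emp0 s) × bit z + (bit r + sz s) ≤ dv x)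
  ub-d (incl m) =
    let s , u , e , h = ub-b0 m in true , false , s , unq-incl u e , inj₁ refl , s≤s h
  ub-d (excl q) =
    let s , u , e , h = ub-b1 q in false , false , s , unq-excl u (inj₂ e) , inj₂ e , h

-- Values of matchings connected by small steps

Near : ℕ → ℕ → Set
Near i j = i ≤ suc j × j ≤ suc i

near-refl : ∀ {i} → Near i i
near-refl = n≤1+n _ , n≤1+n _

near-sym : ∀ {i j} → Near i j → Near j i
near-sym (p , q) = q , p

near-suc : ∀ {i j} → Near i j → Near (suc i) (suc j)
near-suc (p , q) = s≤s p , s≤s q

near-⊓ : ∀ {i j k l} → Near i j → Near k l → Near (i ⊓ k) (j ⊓ l)
near-⊓ (p , q) (p′ , q′) = ⊓-mono-≤ p p′ , ⊓-mono-≤ q q′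

near-+ʳ : ∀ {i j} k → Near i j → Near (i + k) (j + k)
near-+ʳ k (p , q) = +-monoˡ-≤ k p , +-monoˡ-≤ k q

near-+ˡ : ∀ {i j} k → Near i j → Near (k + i) (k + j)
near-+ˡ {i} {j} k (p , q) =
  ≤-trans (+-monoʳ-≤ k p) (≤-reflexive (+-suc k j)) ,
  ≤-trans (+-monoʳ-≤ k q) (≤-reflexive (+-suc k i))

Close0 : ∀ {T} → M0 T → M0 T → Set
Close0 m n = Near (a0 m) (a0 n) × Near (b0 m) (b0 n)

CloseC : ∀ {T} → MC T → MC T → Set
CloseC x y = Near (cv x) (cv y) × Near (dv x) (dv y)

closeC-sym : ∀ {T} {x y : MC T} → CloseC x y → CloseC y x
closeC-sym (p , q) = near-sym p , near-sym q

close-fork1 : ∀ {B C} (m m′ : M0 B) (n n′ : M0 C) →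
  Near (a0 m + a0 n) (a0 m′ + a0 n′) →
  Near ((b0 m + a0 n) ⊓ (a0 m + b0 n)) ((b0 m′ + a0 n′) ⊓ (a0 m′ + b0 n′)) →
  CloseC (excl (fork m n)) (excl (fork m′ n′))
close-fork1 m m′ n n′ p q = near-⊓ (near-suc p) (near-suc q) , near-suc q

-- What is needed of two branches to connect the two halves of MC of their fork (bridge).
data Seed (T : Shape) : Set where
  rising : (m : M0 T) (x : MC T) → b0 m ≡ suc (a0 m) → cv x ≡ suc (a0 m) → dv x ≡ suc (a0 m) → Seed T
  flat   : (m : M0 T) → b0 m ≡ a0 m → Seed T

⊓-lin : ∀ {B} (x : MC B) → cv {lin B} (excl (lin x)) ≡ dv x
⊓-lin x = m≥n⇒m⊓n≡n (dv≤1+cv x)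

-- If the branch meets the demand of `dv` at no additional cost, then excluding the `M1` of the fork
-- is free.
cv≡dv⇒flatˡ : ∀ {B C} (x : MC B) (y : MC C) → cv x ≡ dv x → b0 (fork x y) ≡ a0 (fork x y)
cv≡dv⇒flatˡ x y eq rewrite sym eq = m≤n⇒m⊓n≡m (+-monoʳ-≤ (cv x) (cv≤dv y))

cv≡dv⇒flatʳ : ∀ {B C} (x : MC B) (y : MC C) → cv y ≡ dv y → b0 (fork x y) ≡ a0 (fork x y)
cv≡dv⇒flatʳ x y eq rewrite sym eq = m≥n⇒m⊓n≡n (+-monoˡ-≤ (cv y) (cv≤dv x))

-- At a fork, `closure` is what a seed contributes to the matching with the root edge, and
-- `matching` what it contributes to the one without.
closure : ∀ {T} → Seed T → MC T
closure (rising _ x _ _ _) = x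
closure (flat m _)         = incl m

matching : ∀ {T} → Seed T → M0 T
matching (rising m _ _ _ _) = m
matching (flat m _)         = m

flat-flat : ∀ {B C} (m : M0 B) (n : M0 C) → b0 m ≡ a0 m → b0 n ≡ a0 n → Seed (fork B C)
flat-flat m n p q = rising (fork (incl m) (incl n)) (excl (fork m n)) u v w
  where
    u : b0 (fork (incl m) (incl n)) ≡ suc (a0 (fork (incl m) (incl n)))
    u rewrite +-suc (b0 m) (b0 n) | ⊓-idem (b0 m + b0 n) = refl
    v : cv (excl (fork m n)) ≡ suc (a0 (fork (incl m) (incl n)))
    v rewrite p | q | ⊓-idem (a0 m + a0 n) | ⊓-idem (a0 m + a0 n) = refl
    w : dv (excl (fork m n)) ≡ suc (a0 (fork (incl m) (incl n)))
    w rewrite p | q | ⊓-idem (a0 m + a0 n) = refl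

-- A single hexagon above a seed of either type gives a rising one. A fork with a rising branch is
-- flat, because there `cv` and `dv` agree; a fork of two flat branches is rising.
seed : ∀ T → Seed T
seed nil = flat nil refl
seed (lin B) with seed B
... | flat m eq         = rising (lin m) (excl (lin (incl m))) refl
                            (trans (⊓-lin (incl m)) (cong suc eq)) (cong suc eq)
... | rising m x _ _ eq = rising (lin m) (excl (lin x)) refl (trans (⊓-lin x) eq) eq
seed (fork B C) with seed B | seed C
... | rising _ x _ p q | s                = flat (fork x (closure s)) (cv≡dv⇒flatˡ x (closure s) (trans p (sym q)))
... | flat m _         | rising _ y _ p q = flat (fork (incl m) y) (cv≡dv⇒flatʳ (incl m) y (trans p (sym q)))
... | flat m p         | flat n q         = flat-flat m n p q

-- Write `a` for `a0 m + a0 n`. The pairs of `cv` and `dv` are `(a + 2 , a + 3)` and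
-- `(a + 1 , a + 2)` when both seeds are rising, and `(a + 1 , a + 2)` and `(a + 1 , a + 1)` in the
-- other three cases.
bridge : ∀ {B C} (s : Seed B) (t : Seed C) →
         CloseC (incl (fork (closure s) (closure t))) (excl (fork (matching s) (matching t)))
bridge (flat m p) (flat n q)
  rewrite p | q | +-suc (a0 m) (a0 n) | ⊓-idem (a0 m + a0 n) | ⊓-idem (a0 m + a0 n)
  = near-refl , ≤-refl , m≤n+m _ 2
bridge (flat m p) (rising n y q r t)
  rewrite p | q | r | t | +-suc (a0 m) (a0 n)
        | m≥n⇒m⊓n≡n (n≤1+n (a0 m + a0 n)) | m≤n⇒m⊓n≡m (n≤1+n (a0 m + a0 n)) | ⊓-idem (a0 m + a0 n)
  = near-refl , ≤-refl , m≤n+m _ 2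
bridge (rising m x p r t) (flat n q)
  rewrite p | q | r | t | +-suc (a0 m) (a0 n)
        | m≤n⇒m⊓n≡m (n≤1+n (a0 m + a0 n)) | m≥n⇒m⊓n≡n (n≤1+n (a0 m + a0 n)) | ⊓-idem (a0 m + a0 n)
  = near-refl , ≤-refl , m≤n+m _ 2
bridge (rising m x p r t) (rising n y q r′ t′)
  rewrite p | q | r | r′ | t | t′ | +-suc (a0 m) (a0 n)
        | ⊓-idem (a0 m + a0 n) | m≤n⇒m⊓n≡m (n≤1+n (a0 m + a0 n))
  = (≤-refl , m≤n+m _ 2) , (≤-refl , m≤n+m _ 2)

close-lin : ∀ {B} (x y : MC B) → CloseC x y → CloseC (excl (lin x)) (excl (lin y))
close-lin x y (p , q) = near-⊓ (near-suc p) q , q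

-- A rotation of the hexagon: the pairs of `cv` and `dv` are `(1 + a0 m , 2 + a0 m)` before and
-- `(1 + b0 m , 1 + b0 m)` after, and `b0 m` exceeds `a0 m` by at most one.
lin-incl≈lin-excl : ∀ {B} (m : M0 B) → CloseC (incl (lin m)) (excl (lin (incl m)))
lin-incl≈lin-excl m rewrite ⊓-idem (b0 m) =
  (s≤s (≤-trans (a0≤b0 m) (n≤1+n _)) , s≤s (b0≤1+a0 m)) ,
  (s≤s (s≤s (a0≤b0 m)) , s≤s (≤-trans (b0≤1+a0 m) (n≤1+n _)))

conn-sum : ∀ {T} → (∀ m n → Star (CloseC {T}) (incl m) (incl n)) → (∀ p q → Star (CloseC {T}) (excl p) (excl q)) →
           ∀ m₀ q₀ → CloseC (incl m₀) (excl q₀) → ∀ x y → Star (CloseC {T}) x y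
conn-sum f g m₀ q₀ h (incl m) (incl n) = f m n
conn-sum f g m₀ q₀ h (incl m) (excl q)  = f m m₀ ◅◅ h ◅ g q₀ q
conn-sum f g m₀ q₀ h (excl q) (incl m)  = g q q₀ ◅◅ closeC-sym {x = incl m₀} {y = excl q₀} h ◅ f m₀ m
conn-sum f g m₀ q₀ h (excl p) (excl q)   = g p q

close-incl : ∀ {T} (m n : M0 T) → Close0 m n → CloseC (incl m) (incl n)
close-incl m n (p , q) = q , near-suc q

conn0 : ∀ {T} (m n : M0 T) → Star Close0 m n
connC : ∀ {T} (x y : MC T) → Star CloseC x y
conn0 nil nil = ε
conn0 (lin m) (lin n) = gmap lin (λ (p , q) → p , near-suc p) (conn0 m n)
conn0 (fork x y) (fork x′ y′) =
  -- The branches are changed one after the other; changing both in one step could move a sum by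
  -- two.
  gmap (λ z → fork z y) (λ (p , q) → near-+ʳ (cv y) p , near-⊓ (near-+ʳ (cv y) q) (near-+ʳ (dv y) p)) (connC x x′) ◅◅
  gmap (fork x′) (λ (p , q) → near-+ˡ (cv x′) p , near-⊓ (near-+ˡ (dv x′) p) (near-+ˡ (cv x′) q)) (connC y y′)
connC {nil} (incl nil) (incl nil) = ε
connC {lin B} = conn-sum (λ m n → gmap incl (λ {m} {n} → close-incl m n) (conn0 m n))
  (λ { (lin x) (lin y) → gmap (λ z → excl (lin z)) (λ {x} {y} → close-lin x y) (connC x y) })
  (lin m₀) (lin (incl m₀)) (lin-incl≈lin-excl m₀)
  where
    m₀ : M0 B
    m₀ = matching (seed B)
connC {fork B C} = conn-sum (λ m n → gmap incl (λ {m} {n} → close-incl m n) (conn0 m n))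
  (λ { (fork m n) (fork m′ n′) →
    gmap (λ z → excl (fork z n)) (λ {z} {z′} (p , q) →
      close-fork1 z z′ n n (near-+ʳ (a0 n) p) (near-⊓ (near-+ʳ (a0 n) q) (near-+ʳ (b0 n) p))) (conn0 m m′) ◅◅
    gmap (λ z → excl (fork m′ z)) (λ {z} {z′} (p , q) →
      close-fork1 m′ m′ z z′ (near-+ˡ (a0 m′) p) (near-⊓ (near-+ˡ (b0 m′) p) (near-+ˡ (a0 m′) q))) (conn0 n n′) })
  (fork (closure (seed B)) (closure (seed C))) (fork (matching (seed B)) (matching (seed C)))
  (bridge (seed B) (seed C))

-- From chains to an interval of values

interpolate : ∀ {A : Set} (f : A → ℕ) {R : A → A → Set} → (∀ {x y} → R x y → Near (f x) (f y)) →
              ∀ {x y} → Star R x y → ∀ {k} → f x ≤ k → k ≤ f y → ∃[ z ] f z ≡ k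
interpolate f near {x} ε p q = x , ≤-antisym p q
interpolate f near {x} (_◅_ {j = y} r rs) {k} p q with f y ≤? k
... | yes h = interpolate f near rs h q
-- Here `k < f y` and `f y ≤ 1 + f x`, so the value `k` is already taken before the step.
... | no ¬h = x , ≤-antisym p (≤-pred (≤-trans (≰⇒> ¬h) (proj₂ (near r))))

enum0 : ∀ T → List (M0 T)
enum1 : ∀ T → List (M1 T)
enumC : ∀ T → List (MC T)
enum0 nil        = nil ∷ []
enum0 (lin B)    = map lin (enum0 B)
enum0 (fork B C) = cartesianProductWith fork (enumC B) (enumC C)
enum1 nil        = []
enum1 (lin B)    = map lin (enumC B)
enum1 (fork B C) = cartesianProductWith fork (enum0 B) (enum0 C)
enumC T          = map incl (enum0 T) ++ map excl (enum1 T)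

∈-enum0 : ∀ {T} (m : M0 T) → m ∈ enum0 T
∈-enum1 : ∀ {T} (q : M1 T) → q ∈ enum1 T
∈-enumC : ∀ {T} (x : MC T) → x ∈ enumC T
∈-enum0 nil        = here refl
∈-enum0 (lin m)    = ∈-map⁺ lin (∈-enum0 m)
∈-enum0 (fork x y) = ∈-cartesianProductWith⁺ fork (∈-enumC x) (∈-enumC y)
∈-enum1 (lin x)    = ∈-map⁺ lin (∈-enumC x)
∈-enum1 (fork m n) = ∈-cartesianProductWith⁺ fork (∈-enum0 m) (∈-enum0 n)
∈-enumC (incl m)    = ∈-++⁺ˡ (∈-map⁺ incl (∈-enum0 m))
∈-enumC {T} (excl q) = ∈-++⁺ʳ (map incl (enum0 T)) (∈-map⁺ excl (∈-enum1 q))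

cv-range : ∀ T → Σ (MC T) λ lo → Σ (MC T) λ hi → ((x : MC T) → cv lo ≤ cv x × cv x ≤ cv hi)
cv-range T = argmin (cv {T}) x₀ (enumC T) , argmax (cv {T}) x₀ (enumC T) , λ x →
  All.lookup (f[argmin]≤f[xs] {f = cv {T}} x₀ (enumC T)) (∈-enumC x) ,
  All.lookup (f[xs]≤f[argmax] {f = cv {T}} x₀ (enumC T)) (∈-enumC x)
  where
    x₀ : MC T
    x₀ = closure (seed T)

cv-interval : ∀ T → ∃[ a ] ∃[ b ] (a ≤ b × (∀ k → (∃[ x ] cv {T} x ≡ k) → a ≤ k × k ≤ b)
                                   × (∀ k → a ≤ k → k ≤ b → ∃[ x ] cv {T} x ≡ k))
cv-interval T with cv-range T
... | lo , hi , bound = cv lo , cv hi , proj₁ (bound hi) , (λ { _ (x , refl) → bound x }) ,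
      λ k p q → interpolate cv {CloseC {T}} proj₁ (connC lo hi) p q

-- Exploring a cata-condensed system from its root

open DecMembership _≟H_ using () renaming (_∈?_ to _∈H?_)

-- Reg H h k T: the hexagons of H met from h on without crossing side k form the shape T.
data Reg (H : List Hex) : Hex → Dir → Shape → Set where
  nil  : ∀ {h k} → h ∉ H → Reg H h k nil
  lin  : ∀ {h k B} → h ∈ H →
         nbr h (r k) ∉ H → nbr h (r² k) ∉ H → nbr h (r⁴ k) ∉ H → nbr h (r⁵ k) ∉ H →
         Reg H (nbr h (r³ k)) (r³ (r³ k)) B → Reg H h k (lin B)
  fork : ∀ {h k B C} → h ∈ H →
         nbr h (r k) ∉ H → nbr h (r³ k) ∉ H → nbr h (r⁵ k) ∉ H →
         Reg H (nbr h (r² k)) (r³ (r² k)) B → Reg H (nbr h (r⁴ k)) (r³ (r⁴ k)) C →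
         Reg H h k (fork B C)

hexes : ∀ {H h k T} → Reg H h k T → List Hex
hexes (nil _)                        = []
hexes (lin {h = h} _ _ _ _ _ R)      = h ∷ hexes R
hexes (fork {h = h} _ _ _ _ R Q)     = h ∷ hexes R ++ hexes Q

Sep : ∀ {H h k T} → Reg H h k T → Set
Sep (nil _) = ⊤
Sep (lin {h = h} _ _ _ _ _ R) = h ∉ hexes R × Sep R
Sep (fork {h = h} _ _ _ _ R Q) =
  h ∉ hexes R × h ∉ hexes Q × (∀ {x} → x ∈ hexes R → x ∉ hexes Q) × Sep R × Sep Q

Unique-++⁻ˡ : ∀ {A : Set} (xs : List A) {ys} → Unique (xs ++ ys) → Unique xs
Unique-++⁻ˡ []       u       = []
Unique-++⁻ˡ (x ∷ xs) (p ∷ u) = All.++⁻ˡ xs p ∷ Unique-++⁻ˡ xs u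

unique⊆⇒length≤ : ∀ {A : Set} {xs ys : List A} → Unique xs → (∀ {x} → x ∈ xs → x ∈ ys) → length xs ≤ length ys
unique⊆⇒length≤ [] _ = z≤n
unique⊆⇒length≤ {xs = x ∷ xs} {ys} (x∉xs ∷ u) sub with ∈-∃++ (sub (here refl))
... | us , vs , refl = ≤-trans (s≤s (unique⊆⇒length≤ u sub′))
        (≤-reflexive (trans (cong suc (length-++ us)) (sym (trans (length-++ us) (+-suc (length us) (length vs))))))
  where
    sub′ : ∀ {y} → y ∈ xs → y ∈ us ++ vs
    sub′ y∈xs with ∈-++⁻ us (sub (there y∈xs))
    ... | inj₁ p              = ∈-++⁺ˡ p
    ... | inj₂ (here refl)    = ⊥-elim (All.lookup x∉xs y∈xs refl)
    ... | inj₂ (there p)      = ∈-++⁺ʳ us p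

close-cycle : ∀ {A : Set} {R : A → A → Set} x y zs {c us z} →
              Linked R (x ∷ y ∷ zs ++ c ∷ us) → R c z → Linked R (x ∷ y ∷ (zs ++ c ∷ []) ∷ʳ z)
close-cycle x y []       (p ∷ q ∷ l) s = p ∷ q ∷ s ∷ [-]
close-cycle x y (w ∷ zs) (p ∷ l)     s = p ∷ close-cycle y w zs l s

module _ {H : List Hex} (acyclic : DualAcyclic H) where

  -- The three hexagons around a common corner are pairwise adjacent, a cycle in the inner dual.
  -- This is what leaves only `lin` and `fork` as shapes.
  triangle : ∀ {h} k → h ∈ H → nbr h k ∈ H → nbr h (r k) ∉ H
  triangle {h} k p q s = acyclic h (nbr h k ∷ nbr h (r k) ∷ [])
    ( s≤s (s≤s z≤n)
    , ((≢-sym (nbr≢ h k) ∷ ≢-sym (nbr≢ h (r k)) ∷ []) ∷ (ne ∷ []) ∷ [] ∷ [])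
    , p ∷ q ∷ s ∷ []
    , adjacent-nbr h k
      ∷ subst (Adjacent (nbr h k)) (nbr-left h k) (adjacent-nbr (nbr h k) (r² k))
      ∷ adjacent-sym (adjacent-nbr h (r k)) ∷ [-] )
    where
      ne : nbr h k ≢ nbr h (r k)
      ne e = nbr≢ (nbr h k) (r² k) (trans (nbr-left h k) (sym e))

  -- A neighbour `c` of `h` further back on the path would close the stretch from `h` to `c` into a
  -- cycle.
  no-return : ∀ {h p ps c} → Linked Adjacent (h ∷ p ∷ ps) → Unique (h ∷ p ∷ ps) → All (_∈ H) (h ∷ p ∷ ps) →
              Adjacent c h → c ∉ ps
  no-return {h} {p} lk u al adj c∈ps with ∈-∃++ c∈ps
  ... | us , vs , refl = acyclic h (p ∷ us ++ _ ∷ [])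
    ( long us , Unique-++⁻ˡ (h ∷ p ∷ us ++ _ ∷ []) (subst (λ z → Unique (h ∷ p ∷ z)) eq u)
    , All.++⁻ˡ (h ∷ p ∷ us ++ _ ∷ []) (subst (λ z → All (_∈ H) (h ∷ p ∷ z)) eq al)
    , close-cycle h p us lk adj )
    where
      eq : us ++ _ ∷ vs ≡ (us ++ _ ∷ []) ++ vs
      eq = sym (++-assoc us (_ ∷ []) vs)
      long : ∀ us {c : Hex} → 2 ≤ suc (length (us ++ c ∷ []))
      long []      = s≤s (s≤s z≤n)
      long (_ ∷ _) = s≤s (s≤s z≤n)

root∈ : ∀ {H h k T} (R : Reg H h k T) → h ∈ H → h ∈ hexes R
root∈ (nil h∉)             h∈ = ⊥-elim (h∉ h∈)
root∈ (lin _ _ _ _ _ _)    h∈ = here refl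
root∈ (fork _ _ _ _ _ _)   h∈ = here refl

hexes⊆ : ∀ {H h k T} (R : Reg H h k T) {x} → x ∈ hexes R → x ∈ H
hexes⊆ (lin p _ _ _ _ R)  (here refl) = p
hexes⊆ (lin p _ _ _ _ R)  (there x∈)  = hexes⊆ R x∈
hexes⊆ (fork p _ _ _ R Q) (here refl) = p
hexes⊆ (fork p _ _ _ R Q) (there x∈)  = [ hexes⊆ R , hexes⊆ Q ]′ (∈-++⁻ (hexes R) x∈)

-- `Reg` records that all sides of its hexagon other than the root side and those of the branches
-- lead out of `H`, and a branch can be left only across its own root side, which leads back to `h`.
exit : ∀ {H h k T} (R : Reg H h k T) {b} l → b ∈ hexes R → nbr b l ∈ H → nbr b l ∈ hexes R ⊎ (b ≡ h × l ≡ k)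
exit {H} {h} {k} (lin p n₁ n₂ n₄ n₅ R) l (here refl) =
  all-turns {P = λ l → nbr h l ∈ H → nbr h l ∈ h ∷ hexes R ⊎ (h ≡ h × l ≡ k)} k
    (λ _ → inj₂ (refl , refl)) (λ q → ⊥-elim (n₁ q)) (λ q → ⊥-elim (n₂ q))
    (λ q → inj₁ (there (root∈ R q))) (λ q → ⊥-elim (n₄ q)) (λ q → ⊥-elim (n₅ q)) l
exit {h = h} {k} (lin p n₁ n₂ n₄ n₅ R) l (there b∈) q with exit R l b∈ q
... | inj₁ s             = inj₁ (there s)
... | inj₂ (refl , refl) = inj₁ (here (nbr-back h (r³ k)))
exit {H} {h} {k} (fork p n₁ n₃ n₅ R Q) l (here refl) =
  all-turns {P = λ l → nbr h l ∈ H → nbr h l ∈ h ∷ hexes R ++ hexes Q ⊎ (h ≡ h × l ≡ k)} k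
    (λ _ → inj₂ (refl , refl)) (λ q → ⊥-elim (n₁ q)) (λ q → inj₁ (there (∈-++⁺ˡ (root∈ R q))))
    (λ q → ⊥-elim (n₃ q)) (λ q → inj₁ (there (∈-++⁺ʳ (hexes R) (root∈ Q q)))) (λ q → ⊥-elim (n₅ q)) l
exit {h = h} {k} (fork p n₁ n₃ n₅ R Q) l (there b∈) q with ∈-++⁻ (hexes R) b∈
... | inj₁ b∈R with exit R l b∈R q
...   | inj₁ s             = inj₁ (there (∈-++⁺ˡ s))
...   | inj₂ (refl , refl) = inj₁ (here (nbr-back h (r² k)))
exit {h = h} {k} (fork p n₁ n₃ n₅ R Q) l (there b∈) q | inj₂ b∈Q with exit Q l b∈Q q
...   | inj₁ s             = inj₁ (there (∈-++⁺ʳ (hexes R) s))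
...   | inj₂ (refl , refl) = inj₁ (here (nbr-back h (r⁴ k)))

climb : ∀ {H h k T} (R : Reg H h k T) {P : Hex → Set} →
        (∀ b l → P b → nbr b l ∈ hexes R → P (nbr b l)) → ∀ {x} → x ∈ hexes R → P x → P h
climb (lin p _ _ _ _ R) step (here refl) px = px
climb {h = h} {k} (lin p _ _ _ _ R) {P} step (there x∈) px =
  subst P (nbr-back h (r³ k)) (step (nbr h (r³ k)) (r³ (r³ k)) (climb R {P} (λ b l pb q → step b l pb (there q)) x∈ px)
    (here (nbr-back h (r³ k))))
climb (fork p _ _ _ R Q) step (here refl) px = px
climb {h = h} {k} (fork p _ _ _ R Q) {P} step (there x∈) px with ∈-++⁻ (hexes R) x∈
... | inj₁ x∈R = subst P (nbr-back h (r² k)) (step (nbr h (r² k)) (r³ (r² k))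
    (climb R {P} (λ b l pb q → step b l pb (there (∈-++⁺ˡ q))) x∈R px)
    (here (nbr-back h (r² k))))
... | inj₂ x∈Q = subst P (nbr-back h (r⁴ k)) (step (nbr h (r⁴ k)) (r³ (r⁴ k))
    (climb Q {P} (λ b l pb q → step b l pb (there (∈-++⁺ʳ (hexes R) q))) x∈Q px)
    (here (nbr-back h (r⁴ k))))

-- A hexagon common to two branches at h could be climbed from inside the first
-- branch to the root of the second, and from there the first branch exits to h.
branches-disjoint : ∀ {H h k l B C} → h ∈ H → k ≢ l →
  (R : Reg H (nbr h k) (r³ k) B) (Q : Reg H (nbr h l) (r³ l) C) → h ∉ hexes R → h ∉ hexes Q →
  ∀ {x} → x ∈ hexes R → x ∉ hexes Q
branches-disjoint {H} {h} {k} {l} h∈ k≢l R Q h∉R h∉Q x∈R x∈Q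
  with exit R (r³ l) (climb Q {_∈ hexes R} stay x∈Q x∈R) (subst (_∈ H) (sym (nbr-back h l)) h∈)
  where
    stay : ∀ b m → b ∈ hexes R → nbr b m ∈ hexes Q → nbr b m ∈ hexes R
    stay b m b∈ q with exit R m b∈ (hexes⊆ Q q)
    ... | inj₁ s             = s
    ... | inj₂ (refl , refl) = ⊥-elim (h∉Q (subst (_∈ hexes Q) (nbr-back h k) q))
... | inj₁ q       = h∉R (subst (_∈ hexes R) (nbr-back h l) q)
... | inj₂ (q , _) = k≢l (sym (nbr-inj h q))

k≢rk : ∀ k → k ≢ r k
k≢rk = all-dirs (λ ()) (λ ()) (λ ()) (λ ()) (λ ()) (λ ())

k≢r²k : ∀ k → k ≢ r² k
k≢r²k = all-dirs (λ ()) (λ ()) (λ ()) (λ ()) (λ ()) (λ ())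

k≢r³k : ∀ k → k ≢ r³ k
k≢r³k = all-dirs (λ ()) (λ ()) (λ ()) (λ ()) (λ ()) (λ ())

k≢r⁴k : ∀ k → k ≢ r⁴ k
k≢r⁴k = all-dirs (λ ()) (λ ()) (λ ()) (λ ()) (λ ()) (λ ())

k≢r⁵k : ∀ k → k ≢ r⁵ k
k≢r⁵k = all-dirs (λ ()) (λ ()) (λ ()) (λ ()) (λ ()) (λ ())

module _ {H : List Hex} (acyclic : DualAcyclic H) where

  -- The part of H that is reached from h without crossing side k, given a path ps from h
  -- back to the root along which H has already been explored; n bounds the remaining depth.
  explore : ∀ n h k ps → length H ≤ n + length ps →
    Linked Adjacent (h ∷ ps) → Unique (h ∷ ps) → All (_∈ H) (h ∷ ps) →
    (∀ l → l ≢ k → nbr h l ∉ ps) → nbr h (r k) ∉ H → nbr h (r⁵ k) ∉ H →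
    ∃[ T ] Σ (Reg H h k T) λ R → Sep R × (∀ {x} → x ∈ hexes R → x ∉ ps)

  descend : ∀ n h k ps → length H ≤ suc n + length ps →
    Linked Adjacent (h ∷ ps) → Unique (h ∷ ps) → All (_∈ H) (h ∷ ps) →
    (∀ l → l ≢ k → nbr h l ∉ ps) → ∀ l → l ≢ k →
    ∃[ T ] Σ (Reg H (nbr h l) (r³ l) T) λ R → Sep R × (∀ {x} → x ∈ hexes R → x ∉ h ∷ ps)
  descend n h k ps bd lk un al new l l≢k with nbr h l ∈H? H
  ... | no ∉H  = nil , nil ∉H , _ , λ ()
  ... | yes ∈H = explore n (nbr h l) (r³ l) (h ∷ ps) (≤-trans bd (≤-reflexive (sym (+-suc n _))))
      lk′ un′ (∈H ∷ al) new′
      -- The two neighbours next to the entry side of `nbr h l` are also neighbours of `h`, so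
      -- `triangle` at `h` excludes both.
      (subst (_∉ H) (sym (nbr-right h l)) (λ q → triangle acyclic (r⁵ l) (All.head al) q (subst (λ m → nbr h m ∈ H) (sym (r⁶ l)) ∈H)))
      (subst (_∉ H) (sym (trans (cong (nbr (nbr h l)) (cong (λ m → r (r m)) (r⁶ l))) (nbr-left h l))) (triangle acyclic l (All.head al) ∈H))
    where
      lk′ : Linked Adjacent (nbr h l ∷ h ∷ ps)
      lk′ = adjacent-sym (adjacent-nbr h l) ∷ lk
      un′ : Unique (nbr h l ∷ h ∷ ps)
      un′ = (nbr≢ h l ∷ All.¬Any⇒All¬ ps (new l l≢k)) ∷ un
      new′ : ∀ m → m ≢ r³ l → nbr (nbr h l) m ∉ h ∷ ps
      new′ m m≢ (here e)  = m≢ (nbr-inj (nbr h l) (trans e (sym (nbr-back h l))))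
      new′ m m≢ (there q) = no-return acyclic lk′ un′ (∈H ∷ al) (adjacent-sym (adjacent-nbr (nbr h l) m)) q

  explore zero h k ps bd lk un al new n₁ n₅ =
    -- With no depth left, `h ∷ ps` would be a duplicate-free list of hexagons of `H` longer than
    -- `H` itself.
    ⊥-elim (<-irrefl refl (≤-trans (unique⊆⇒length≤ un (All.lookup al)) bd))
  explore (suc n) h k ps bd lk un@(h∉ps ∷ _) al new n₁ n₅ with nbr h (r³ k) ∈H? H
  ... | yes ∈H =
    let T , R , sep , av = descend n h k ps bd lk un al new (r³ k) (≢-sym (k≢r³k k))
    in lin T
     , lin (All.head al) n₁ (λ q → triangle acyclic (r² k) (All.head al) q ∈H) (triangle acyclic (r³ k) (All.head al) ∈H) n₅ R
     , ((λ q → av q (here refl)) , sep)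
     , λ { (here refl) q → All.lookup h∉ps q refl ; (there x∈) q → av x∈ (there q) }
  -- A hexagon without branches ends up here too, as a fork of two `nil`s.
  ... | no ∉H =
    let T , R , sep , av = descend n h k ps bd lk un al new (r² k) (≢-sym (k≢r²k k))
        U , Q , sep′ , av′ = descend n h k ps bd lk un al new (r⁴ k) (≢-sym (k≢r⁴k k))
        h∉R = λ q → av q (here refl)
        h∉Q = λ q → av′ q (here refl)
    in fork T U
     , fork (All.head al) n₁ ∉H n₅ R Q
     , ( h∉R , h∉Q , branches-disjoint (All.head al) (k≢r²k (r² k)) R Q h∉R h∉Q , sep , sep′)
     , λ { (here refl) q → All.lookup h∉ps q refl
         ; (there x∈) q → [ (λ x∈R → av x∈R (there q)) , (λ x∈Q → av′ x∈Q (there q)) ]′ (∈-++⁻ (hexes R) x∈) }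

walk-start : ∀ {H a b} → Walk H a b → a ∈ H
walk-start (here p)      = p
walk-start (there p _ _) = p

covered : ∀ {H h k T} (R : Reg H h k T) → nbr h k ∉ H → ∀ {a b} → Walk H a b → a ∈ hexes R → b ∈ hexes R
covered R out (here _)         a∈ = a∈
covered {H} R out (there _ adj w) a∈ with adjacent⇒nbr adj
... | l , refl with exit R l a∈ (walk-start w)
...   | inj₁ q             = covered R out w q
...   | inj₂ (refl , refl) = ⊥-elim (out (walk-start w))

record Rooted (H : List Hex) : Set where
  field
    {root}  : Hex
    {dir}   : Dir
    {shape} : Shape
    region  : Reg H root dir shape
    sep     : Sep region
    root∈H  : root ∈ H
    out     : nbr root dir ∉ H
    outʳ    : nbr root (r dir) ∉ H
    outˡ    : nbr root (r⁵ dir) ∉ H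
    cover   : ∀ {x} → x ∈ H → x ∈ hexes region

rooted : ∀ {H} → CataCondensed H → Rooted H
rooted {[]} (ne , _) = ⊥-elim (ne refl)
rooted {x ∷ xs} (_ , _ , conn , acyclic) with largest x xs
... | top , top∈ , max =
  let T , R , separate , _ = explore acyclic (length (x ∷ xs)) top d2 []
        (≤-reflexive (sym (+-identityʳ _))) [-] ([] ∷ []) (top∈ ∷ []) (λ _ _ ())
        (λ q → max q (≺-nbr₃ top)) (λ q → max q (≺-nbr₁ top))
  in record
    { region = R ; sep = separate ; root∈H = top∈
    ; out  = λ q → max q (≺-nbr₂ top)
    ; outʳ = λ q → max q (≺-nbr₃ top)
    ; outˡ = λ q → max q (≺-nbr₁ top)
    ; cover = λ q → covered R (λ q → max q (≺-nbr₂ top)) (conn top∈ q) (root∈ R top∈)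
    }

-- Edges of a region

toList : ∀ {A T} → Lab A T → List A
toList nil                       = []
toList (lin a b c d e l)         = a ∷ b ∷ c ∷ d ∷ e ∷ toList l
toList (fork a b c d e l l′)     = a ∷ b ∷ c ∷ d ∷ e ∷ toList l ++ toList l′

labels : ∀ {H h k T} → Reg H h k T → Lab Edge T
labels (nil _) = nil
labels (lin {h = h} {k} _ _ _ _ _ R) =
  lin (side h (r k)) (side h (r² k)) (side h (r³ k)) (side h (r⁴ k)) (side h (r⁵ k)) (labels R)
labels (fork {h = h} {k} _ _ _ _ R Q) =
  fork (side h (r k)) (side h (r² k)) (side h (r³ k)) (side h (r⁴ k)) (side h (r⁵ k)) (labels R) (labels Q)

edges : ∀ {H h k T} → Reg H h k T → List Edge
edges R = toList (labels R)

turns : Hex → Dir → List Edge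
turns h k = side h (r k) ∷ side h (r² k) ∷ side h (r³ k) ∷ side h (r⁴ k) ∷ side h (r⁵ k) ∷ []

edges⇒side : ∀ {H h k T} (R : Reg H h k T) {e} → e ∈ edges R → ∃[ b ] ∃[ l ] (b ∈ hexes R × e ≡ side b l)
edges⇒side (lin {h = h} {k} _ _ _ _ _ R) e∈ with ∈-++⁻ (turns h k) e∈
... | inj₁ (here p)                                 = h , _ , here refl , p
... | inj₁ (there (here p))                         = h , _ , here refl , p
... | inj₁ (there (there (here p)))                 = h , _ , here refl , p
... | inj₁ (there (there (there (here p))))         = h , _ , here refl , p
... | inj₁ (there (there (there (there (here p))))) = h , _ , here refl , p
... | inj₂ q = let b , l , b∈ , p = edges⇒side R q in b , l , there b∈ , p
edges⇒side (fork {h = h} {k} _ _ _ _ R Q) e∈ with ∈-++⁻ (turns h k) e∈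
... | inj₁ (here p)                                 = h , _ , here refl , p
... | inj₁ (there (here p))                         = h , _ , here refl , p
... | inj₁ (there (there (here p)))                 = h , _ , here refl , p
... | inj₁ (there (there (there (here p))))         = h , _ , here refl , p
... | inj₁ (there (there (there (there (here p))))) = h , _ , here refl , p
... | inj₂ q with ∈-++⁻ (edges R) q
...   | inj₁ q′ = let b , l , b∈ , p = edges⇒side R q′ in b , l , there (∈-++⁺ˡ b∈) , p
...   | inj₂ q′ = let b , l , b∈ , p = edges⇒side Q q′ in b , l , there (∈-++⁺ʳ (hexes R) b∈) , p

turns-complete : ∀ h k l → side h l ∈ side h k ∷ turns h k
turns-complete h k = all-turns {P = λ l → side h l ∈ side h k ∷ turns h k} k
  (here refl) (there (here refl)) (there (there (here refl))) (there (there (there (here refl))))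
  (there (there (there (there (here refl))))) (there (there (there (there (there (here refl))))))

side⇒edges : ∀ {H h k T} (R : Reg H h k T) {b} → b ∈ hexes R → ∀ l → side b l ∈ side h k ∷ edges R
side⇒edges (lin {h = h} {k} _ _ _ _ _ R) (here refl) l = ∈-++⁺ˡ (turns-complete h k l)
side⇒edges (lin {h = h} {k} _ _ _ _ _ R) (there b∈) l with side⇒edges R b∈ l
... | here p  = there (there (there (here (trans p (side-nbr h (r³ k))))))
... | there q = ∈-++⁺ʳ (side h k ∷ turns h k) q
side⇒edges (fork {h = h} {k} _ _ _ _ R Q) (here refl) l = ∈-++⁺ˡ (turns-complete h k l)
side⇒edges (fork {h = h} {k} _ _ _ _ R Q) (there b∈) l with ∈-++⁻ (hexes R) b∈
... | inj₁ b∈R with side⇒edges R b∈R l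
...   | here p  = there (there (here (trans p (side-nbr h (r² k)))))
...   | there q = ∈-++⁺ʳ (side h k ∷ turns h k) (∈-++⁺ˡ q)
side⇒edges (fork {h = h} {k} _ _ _ _ R Q) (there b∈) l | inj₂ b∈Q with side⇒edges Q b∈Q l
...   | here p  = there (there (there (there (here (trans p (side-nbr h (r⁴ k)))))))
...   | there q = ∈-++⁺ʳ (side h k ∷ turns h k) (∈-++⁺ʳ (edges R) q)

turns-unique : ∀ h k → Unique (side h k ∷ turns h k)
turns-unique h k =
    (ne (k≢rk k) ∷ ne (k≢r²k k) ∷ ne (k≢r³k k) ∷ ne (k≢r⁴k k) ∷ ne (k≢r⁵k k) ∷ [])
  ∷ (ne (k≢rk (r k)) ∷ ne (k≢r²k (r k)) ∷ ne (k≢r³k (r k)) ∷ ne (k≢r⁴k (r k)) ∷ [])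
  ∷ (ne (k≢rk (r² k)) ∷ ne (k≢r²k (r² k)) ∷ ne (k≢r³k (r² k)) ∷ [])
  ∷ (ne (k≢rk (r³ k)) ∷ ne (k≢r²k (r³ k)) ∷ []) ∷ (ne (k≢rk (r⁴ k)) ∷ []) ∷ [] ∷ []
  where
    ne : ∀ {l m} → l ≢ m → side h l ≢ side h m
    ne l≢m e = l≢m (side-inj h e)

-- A common edge puts `nbr h l` into the branch with `h` across that edge. Since `h` is not in the
-- branch, `exit` identifies `nbr h l` with the root of the branch.
branch-side : ∀ {H h k T} (R : Reg H (nbr h k) (r³ k) T) → h ∈ H → h ∉ hexes R →
              ∀ l → side h l ∈ edges R → l ≡ k
branch-side {H} {h} {k} R h∈ h∉R l e∈ with edges⇒side R e∈
... | b , m , b∈ , p with shared-side b m h l (sym p)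
...   | inj₁ (refl , _) = ⊥-elim (h∉R b∈)
...   | inj₂ (refl , _) with exit R (r³ l) b∈ (subst (_∈ H) (sym (nbr-back h l)) h∈)
...     | inj₁ q       = ⊥-elim (h∉R (subst (_∈ hexes R) (nbr-back h l) q))
...     | inj₂ (q , _) = nbr-inj h q

branches-edges : ∀ {H h k l B C} → h ∈ H → k ≢ l →
  (R : Reg H (nbr h k) (r³ k) B) (Q : Reg H (nbr h l) (r³ l) C) → h ∉ hexes R →
  (∀ {x} → x ∈ hexes R → x ∉ hexes Q) → ∀ {e} → e ∈ edges R → e ∉ edges Q
branches-edges {H} {h} {k} {l} h∈ k≢l R Q h∉R disj e∈R e∈Q
  with edges⇒side R e∈R | edges⇒side Q e∈Q
... | b , m , b∈ , p | c , n , c∈ , q with shared-side b m c n (trans (sym p) q)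
...   | inj₁ (refl , _) = disj b∈ c∈
...   | inj₂ (refl , _) with exit Q n c∈ (hexes⊆ R b∈)
...     | inj₁ b∈Q           = disj b∈ b∈Q
...     | inj₂ (refl , refl) = h∉R (subst (_∈ hexes R) (nbr-back h l) b∈)

edges-unique : ∀ {H h k T} (R : Reg H h k T) → Sep R → Unique (side h k ∷ edges R)
edges-unique (nil _) _ = [] ∷ []
edges-unique {H} (lin {h = h} {k} h∈ _ _ _ _ R) (h∉R , sep) with edges-unique R sep
... | root∉ ∷ u = ++⁺ (turns-unique h k) u λ (p , q) → disj p q
  where
    own : ∀ l → side h l ∉ edges R
    own l q with branch-side R h∈ h∉R l q
    ... | refl = All.lookup root∉ q (side-nbr h (r³ k))
    disj : ∀ {e} → e ∈ side h k ∷ turns h k → e ∉ edges R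
    disj (here refl)                                         = own k
    disj (there (here refl))                                 = own (r k)
    disj (there (there (here refl)))                         = own (r² k)
    disj (there (there (there (here refl))))                 = own (r³ k)
    disj (there (there (there (there (here refl)))))         = own (r⁴ k)
    disj (there (there (there (there (there (here refl)))))) = own (r⁵ k)
edges-unique {H} (fork {h = h} {k} h∈ _ _ _ R Q) (h∉R , h∉Q , R∩Q , sep , sep′)
  with edges-unique R sep
     | edges-unique Q sep′
... | root∉ ∷ u | root∉′ ∷ u′ =
  ++⁺ (turns-unique h k) (++⁺ u u′ λ (p , q) → branches-edges h∈ (k≢r²k (r² k)) R Q h∉R R∩Q p q) λ (p , q) → disj p q
  where
    own : ∀ l → side h l ∉ edges R ++ edges Q
    own l q with ∈-++⁻ (edges R) q
    ... | inj₁ q′ with branch-side R h∈ h∉R l q′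
    ...   | refl = All.lookup root∉ q′ (side-nbr h (r² k))
    own l q | inj₂ q′ with branch-side Q h∈ h∉Q l q′
    ...   | refl = All.lookup root∉′ q′ (side-nbr h (r⁴ k))
    disj : ∀ {e} → e ∈ side h k ∷ turns h k → e ∉ edges R ++ edges Q
    disj (here refl)                                         = own k
    disj (there (here refl))                                 = own (r k)
    disj (there (there (here refl)))                         = own (r² k)
    disj (there (there (there (here refl))))                 = own (r³ k)
    disj (there (there (there (there (here refl)))))         = own (r⁴ k)
    disj (there (there (there (there (there (here refl)))))) = own (r⁵ k)

-- Matchings as labellings

one : Bool → Bool → Bool → Bool
one true  true  _     = false
one true  false true  = false
one true  false false = true
one false true  true  = false
one false true  false = true
one false false c     = c

firstEdge lastEdge : ∀ {T} → Lab Bool T → Bool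
firstEdge nil                  = false
firstEdge (lin e _ _ _ _ _)    = e
firstEdge (fork e _ _ _ _ _ _) = e
lastEdge nil                   = false
lastEdge (lin _ _ _ _ e _)     = e
lastEdge (fork _ _ _ _ e _ _)  = e

-- Exactly one matching edge at each corner other than the ends of the root edge; the
-- third edge at such a corner is the first or last edge of a branch, if there is one.
Valid : ∀ {T} → Lab Bool T → Set
Valid nil = ⊤
Valid (lin e₁ e₂ e₃ e₄ e₅ l) =
  one e₁ e₂ false ≡ true × one e₂ e₃ (firstEdge l) ≡ true × one e₃ e₄ (lastEdge l) ≡ true × one e₄ e₅ false ≡ true × Valid l
Valid (fork e₁ e₂ e₃ e₄ e₅ l l′) =
  one e₁ e₂ (firstEdge l) ≡ true × one e₂ e₃ (lastEdge l) ≡ true × one e₃ e₄ (firstEdge l′) ≡ true × one e₄ e₅ (lastEdge l′) ≡ true ×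
  Valid l × Valid l′

-- `false` stands for the third edge at each end of the root edge: it is absent at the root of the
-- whole system, and unmatched wherever a branch is completed inside its parent.
Closed : ∀ {T} → Bool → Lab Bool T → Set
Closed e₀ l = one e₀ (firstEdge l) false ≡ true × one (lastEdge l) e₀ false ≡ true × Valid l

mutual
  lab0 : ∀ {T} → M0 T → Lab Bool T
  lab0 nil        = nil
  lab0 (lin m)    = lin false true false true false (lab0 m)
  lab0 (fork x y) = fork false (rootBit x) false (rootBit y) false (labC x) (labC y)

  lab1 : ∀ {T} → M1 T → Lab Bool T
  lab1 (lin x)    = lin true false (rootBit x) false true (labC x)
  lab1 (fork m n) = fork true false true false true (lab0 m) (lab0 n)

  labC : ∀ {T} → MC T → Lab Bool T
  labC (incl m) = lab0 m
  labC (excl q)  = lab1 q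

  rootBit : ∀ {T} → MC T → Bool
  rootBit (incl _) = true
  rootBit (excl _)  = false

data View {T} : Lab Bool T → Set where
  is0 : (m : M0 T) → View (lab0 m)
  is1 : (q : M1 T) → View (lab1 q)

first-lab0 : ∀ {T} (m : M0 T) → firstEdge (lab0 m) ≡ false
first-lab0 nil        = refl
first-lab0 (lin _)    = refl
first-lab0 (fork _ _) = refl

last-lab0 : ∀ {T} (m : M0 T) → lastEdge (lab0 m) ≡ false
last-lab0 nil        = refl
last-lab0 (lin _)    = refl
last-lab0 (fork _ _) = refl

first-lab1 : ∀ {T} (q : M1 T) → firstEdge (lab1 q) ≡ true
first-lab1 (lin _)    = refl
first-lab1 (fork _ _) = refl

last-lab1 : ∀ {T} (q : M1 T) → lastEdge (lab1 q) ≡ true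
last-lab1 (lin _)    = refl
last-lab1 (fork _ _) = refl

none : ∀ a b → one a b true ≡ true → a ≡ false × b ≡ false
none true  true  ()
none true  false ()
none false true  ()
none false false _ = refl , refl

other : ∀ a b → one a b false ≡ true → b ≡ not a
other true  false _ = refl
other false true  _ = refl

other′ : ∀ a b → one a b false ≡ true → a ≡ not b
other′ true  false _ = refl
other′ false true  _ = refl

-- Round the hexagon, the corner conditions and the kinds of the branches determine the sides one
-- after another. In particular a branch covers both ends of its root edge or neither, so two kinds
-- suffice.
view : ∀ {T} (l : Lab Bool T) → Valid l → View l
view nil _ = is0 nil
view (lin e₁ e₂ e₃ e₄ e₅ l) (c₁ , c₂ , c₃ , c₄ , v) with view l v
view (lin e₁ e₂ e₃ e₄ e₅ _) (c₁ , c₂ , c₃ , c₄ , v) | is0 m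
  rewrite first-lab0 m | last-lab0 m
  with other e₁ e₂ c₁ | other e₂ e₃ c₂ | other e₃ e₄ c₃ | other e₄ e₅ c₄
view (lin false _ _ _ _ _) _ | is0 m | refl | refl | refl | refl = is0 (lin m)
view (lin true  _ _ _ _ _) _ | is0 m | refl | refl | refl | refl = is1 (lin (incl m))
view (lin e₁ e₂ e₃ e₄ e₅ _) (c₁ , c₂ , c₃ , c₄ , v) | is1 q
  rewrite first-lab1 q | last-lab1 q
  with other′ e₁ e₂ c₁ | none e₂ e₃ c₂ | none e₃ e₄ c₃ | other e₄ e₅ c₄
... | refl | refl , refl | refl , refl | refl = is1 (lin (excl q))
view (fork e₁ e₂ e₃ e₄ e₅ l l′) (c₁ , c₂ , c₃ , c₄ , v , v′) with view l v | view l′ v′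
view (fork e₁ e₂ e₃ e₄ e₅ _ _) (c₁ , c₂ , c₃ , c₄ , _) | is0 m | is0 n
  rewrite first-lab0 m | last-lab0 m | first-lab0 n | last-lab0 n
  with other e₁ e₂ c₁ | other e₂ e₃ c₂ | other e₃ e₄ c₃ | other e₄ e₅ c₄
view (fork false _ _ _ _ _ _) _ | is0 m | is0 n | refl | refl | refl | refl = is0 (fork (incl m) (incl n))
view (fork true  _ _ _ _ _ _) _ | is0 m | is0 n | refl | refl | refl | refl = is1 (fork m n)
view (fork e₁ e₂ e₃ e₄ e₅ _ _) (c₁ , c₂ , c₃ , c₄ , _) | is0 m | is1 q
  rewrite first-lab0 m | last-lab0 m | first-lab1 q | last-lab1 q
  with other′ e₁ e₂ c₁ | other′ e₂ e₃ c₂ | none e₃ e₄ c₃ | none e₄ e₅ c₄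
... | refl | refl | refl , refl | refl , refl = is0 (fork (incl m) (excl q))
view (fork e₁ e₂ e₃ e₄ e₅ _ _) (c₁ , c₂ , c₃ , c₄ , _) | is1 p | is0 n
  rewrite first-lab1 p | last-lab1 p | first-lab0 n | last-lab0 n
  with none e₁ e₂ c₁ | none e₂ e₃ c₂ | other e₃ e₄ c₃ | other e₄ e₅ c₄
... | refl , refl | refl , refl | refl | refl = is0 (fork (excl p) (incl n))
view (fork e₁ e₂ e₃ e₄ e₅ _ _) (c₁ , c₂ , c₃ , c₄ , _) | is1 p | is1 q
  rewrite first-lab1 p | last-lab1 p | first-lab1 q | last-lab1 q
  with none e₁ e₂ c₁ | none e₂ e₃ c₂ | none e₃ e₄ c₃ | none e₄ e₅ c₄
... | refl , refl | refl , refl | refl , refl | refl , refl = is0 (fork (excl p) (excl q))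

closed⇒MC : ∀ {T} e₀ (l : Lab Bool T) → Closed e₀ l → ∃[ x ] (rootBit x ≡ e₀ × labC x ≡ l)
closed⇒MC e₀ l (c , d , v) with view l v
closed⇒MC true  l (c , d , v) | is0 m = incl m , refl , refl
closed⇒MC false l (c , d , v) | is0 m rewrite first-lab0 m = case c of λ ()
closed⇒MC true  l (c , d , v) | is1 q rewrite first-lab1 q = case c of λ ()
closed⇒MC false l (c , d , v) | is1 q = excl q , refl , refl

front : ∀ a b → one false a b ≡ one a b false
front true  true  = refl
front true  false = refl
front false true  = refl
front false false = refl

back : ∀ a b → one a false b ≡ one b a false
back true  true  = refl
back true  false = refl
back false true  = refl
back false false = refl

mutual
  valid0 : ∀ {T} (m : M0 T) → Valid (lab0 m)
  valid0 nil = tt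
  valid0 (lin m) rewrite first-lab0 m | last-lab0 m = refl , refl , refl , refl , valid0 m
  valid0 (fork x y) =
    let p , q , v = closedC x
        p′ , q′ , v′ = closedC y
    in trans (front (rootBit x) (firstEdge (labC x))) p , trans (back (rootBit x) (lastEdge (labC x))) q
     , trans (front (rootBit y) (firstEdge (labC y))) p′ , trans (back (rootBit y) (lastEdge (labC y))) q′ , v , v′

  valid1 : ∀ {T} (q : M1 T) → Valid (lab1 q)
  valid1 (lin x) =
    let p , q , v = closedC x
    in refl , trans (front (rootBit x) (firstEdge (labC x))) p , trans (back (rootBit x) (lastEdge (labC x))) q , refl , v
  valid1 (fork m n) rewrite first-lab0 m | last-lab0 m | first-lab0 n | last-lab0 n =
    refl , refl , refl , refl , valid0 m , valid0 n

  closedC : ∀ {T} (x : MC T) → Closed (rootBit x) (labC x)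
  closedC (incl m) rewrite first-lab0 m | last-lab0 m = refl , refl , valid0 m
  closedC (excl q) rewrite first-lab1 q | last-lab1 q = refl , refl , valid1 q

open DecMembership _≟E_ using (_∈?_)

has : List Edge → Edge → Bool
has M e = does (e ∈? M)

has⁺ : ∀ {M e} → e ∈ M → has M e ≡ true
has⁺ {M} {e} = dec-true (e ∈? M)

has⁻ : ∀ {M e} → has M e ≡ true → e ∈ M
has⁻ {M} {e} p with e ∈? M
... | yes q = q

hasn⁺ : ∀ {M e} → e ∉ M → has M e ≡ false
hasn⁺ {M} {e} = dec-false (e ∈? M)

mapLab : ∀ {A B : Set} {T} → (A → B) → Lab A T → Lab B T
mapLab f nil                       = nil
mapLab f (lin a b c d e l)         = lin (f a) (f b) (f c) (f d) (f e) (mapLab f l)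
mapLab f (fork a b c d e l l′)     = fork (f a) (f b) (f c) (f d) (f e) (mapLab f l) (mapLab f l′)

Once : List Edge → Vertex → Set
Once M v = (∃[ e ] (e ∈ M × Incident v e)) ×
           (∀ {e e′} → e ∈ M → e′ ∈ M → Incident v e → Incident v e′ → e ≡ e′)

edge⇒side : ∀ {H e} → IsEdge H e → ∃[ b ] ∃[ l ] (b ∈ H × e ≡ side b l)
edge⇒side (b , b∈ , e∈) = let l , p = ∈hexEdges⇒side b e∈ in b , l , b∈ , p

one⁺ : ∀ M {a b c e : Edge} → a ≢ b → a ≢ c → b ≢ c → e ∈ M → e ∈ a ∷ b ∷ c ∷ [] →
       (∀ {e e′} → e ∈ a ∷ b ∷ c ∷ [] → e′ ∈ a ∷ b ∷ c ∷ [] → e ∈ M → e′ ∈ M → e ≡ e′) →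
       one (has M a) (has M b) (has M c) ≡ true
one⁺ M {a} {b} {c} a≢b a≢c b≢c e∈M e∈ u with a ∈? M | b ∈? M | c ∈? M
... | yes p | yes q | _     = ⊥-elim (a≢b (u (here refl) (there (here refl)) p q))
... | yes p | no _  | yes q = ⊥-elim (a≢c (u (here refl) (there (there (here refl))) p q))
... | no _  | yes p | yes q = ⊥-elim (b≢c (u (there (here refl)) (there (there (here refl))) p q))
... | yes _ | no _  | no _  = refl
... | no _  | yes _ | no _  = refl
... | no _  | no _  | yes _ = refl
one⁺ M a≢b a≢c b≢c e∈M (here refl)                 u | no p | no _ | no _ = ⊥-elim (p e∈M)
one⁺ M a≢b a≢c b≢c e∈M (there (here refl))         u | no _ | no p | no _ = ⊥-elim (p e∈M)
one⁺ M a≢b a≢c b≢c e∈M (there (there (here refl))) u | no _ | no _ | no p = ⊥-elim (p e∈M)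

one⁻∃ : ∀ M {a b c : Edge} → one (has M a) (has M b) (has M c) ≡ true →
        ∃[ e ] (e ∈ M × e ∈ a ∷ b ∷ c ∷ [])
one⁻∃ M {a} {b} {c} o with a ∈? M | b ∈? M | c ∈? M
... | yes p | _     | _     = a , p , here refl
... | no _  | yes p | _     = b , p , there (here refl)
... | no _  | no _  | yes p = c , p , there (there (here refl))

one⁻! : ∀ M {a b c : Edge} → one (has M a) (has M b) (has M c) ≡ true →
        ∀ {e e′} → e ∈ a ∷ b ∷ c ∷ [] → e′ ∈ a ∷ b ∷ c ∷ [] → e ∈ M → e′ ∈ M → e ≡ e′
one⁻! M {a} {b} {c} o = pick
  where
    ab : a ∈ M → b ∉ M
    ab p q = case subst₂ (λ x y → one x y (has M c) ≡ true) (has⁺ p) (has⁺ q) o of λ ()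
    ac : a ∈ M → c ∉ M
    ac p q with has M b | subst₂ (λ x y → one x (has M b) y ≡ true) (has⁺ p) (has⁺ q) o
    ... | true  | ()
    ... | false | ()
    bc : b ∈ M → c ∉ M
    bc p q with has M a | subst₂ (λ x y → one (has M a) x y ≡ true) (has⁺ p) (has⁺ q) o
    ... | true  | ()
    ... | false | ()
    pick : ∀ {e e′} → e ∈ a ∷ b ∷ c ∷ [] → e′ ∈ a ∷ b ∷ c ∷ [] → e ∈ M → e′ ∈ M → e ≡ e′
    pick (here refl) (here refl) _ _ = refl
    pick (here refl) (there (here refl)) p q = ⊥-elim (ab p q)
    pick (here refl) (there (there (here refl))) p q = ⊥-elim (ac p q)
    pick (there (here refl)) (here refl) p q = ⊥-elim (ab q p)
    pick (there (here refl)) (there (here refl)) _ _ = refl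
    pick (there (here refl)) (there (there (here refl))) p q = ⊥-elim (bc p q)
    pick (there (there (here refl))) (here refl) p q = ⊥-elim (ac q p)
    pick (there (there (here refl))) (there (here refl)) p q = ⊥-elim (bc q p)
    pick (there (there (here refl))) (there (there (here refl))) _ _ = refl

module Local {H : List Hex} {M : List Edge} (M⊆ : All (IsEdge H) M) where

  m : Edge → Bool
  m = has M

  in-star : ∀ h k {e} → e ∈ M → Incident (vert h (r k)) e → e ∈ star h k
  in-star h k e∈ inc with edge⇒side (All.lookup M⊆ e∈)
  ... | b , l , _ , refl = star-complete b l h k inc

  corner-one : Hex → Dir → Bool
  corner-one h k = one (m (side h k)) (m (side h (r k))) (m (spoke h (r k)))

  once⇒one : ∀ h k → Once M (vert h (r k)) → corner-one h k ≡ true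
  once⇒one h k ((e , e∈ , inc) , u) = one⁺ M
    (λ p → k≢rk k (side-inj h p))
    (λ p → k≢rk (r² k) (sym (side-inj (nbr h k) (trans (side-nbr h k) (trans p (sym (spoke′ h k)))))))
    (λ p → k≢rk (r⁴ k) (side-inj (nbr h (r k)) (trans (side-nbr h (r k)) p)))
    e∈ (in-star h k e∈ inc)
    (λ p q p∈ q∈ → u p∈ q∈ (star-incident h k p) (star-incident h k q))

  one⇒once : ∀ h k → corner-one h k ≡ true → Once M (vert h (r k))
  one⇒once h k o =
    (let e , e∈ , p = one⁻∃ M o in e , e∈ , star-incident h k p) ,
    λ p q i j → one⁻! M o (in-star h k p i) (in-star h k q j) p q

  absent : ∀ b l → b ∉ H → nbr b l ∉ H → m (side b l) ≡ false
  absent b l b∉ n∉ = hasn⁺ λ p → let c , n , c∈ , q = edge⇒side (All.lookup M⊆ p) in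
    [ (λ (eq , _) → b∉ (subst (_∈ H) eq c∈)) , (λ (eq , _) → n∉ (subst (_∈ H) eq c∈)) ]′ (shared-side c n b l (sym q))

  -- The spoke lies only in the two hexagons `nbr h l` and `nbr h (r l)`, both outside `H`.
  spoke-absent : ∀ h l → nbr h l ∉ H → nbr h (r l) ∉ H → m (spoke h (r l)) ≡ false
  spoke-absent h l p q = trans (cong m (sym (spoke′ h l)))
    (absent (nbr h l) (r² l) p (subst (_∉ H) (sym (nbr-left h l)) q))

  status : ∀ {h k T} → Reg H h k T → Lab Bool T
  status R = mapLab m (labels R)

  first-child : ∀ {T} h l (R : Reg H (nbr h (r l)) (r³ (r l)) T) → nbr h l ∉ H →
                m (spoke h (r l)) ≡ firstEdge (status R)
  first-child h l (nil p) q = spoke-absent h l q p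
  first-child h l (lin _ _ _ _ _ _)  q = refl
  first-child h l (fork _ _ _ _ _ _) q = refl

  last-child : ∀ {T} h l (R : Reg H (nbr h l) (r³ l) T) → nbr h (r l) ∉ H →
               m (spoke h (r l)) ≡ lastEdge (status R)
  last-child h l (nil p) q = spoke-absent h l p q
  last-child h l (lin _ _ _ _ _ _)  q =
    cong m (trans (sym (spoke′ h l)) (cong (λ k → side (nbr h l) (r² k)) (sym (r⁶ l))))
  last-child h l (fork _ _ _ _ _ _) q =
    cong m (trans (sym (spoke′ h l)) (cong (λ k → side (nbr h l) (r² k)) (sym (r⁶ l))))

  with-spoke : ∀ h k {x} → m (spoke h (r k)) ≡ x → corner-one h k ≡ one (m (side h k)) (m (side h (r k))) x
  with-spoke h k = cong (one (m (side h k)) (m (side h (r k))))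

  valid : ∀ {h k T} (R : Reg H h k T) → (∀ h k → h ∈ H → corner-one h k ≡ true) → Valid (status R)
  valid (nil _) c = tt
  valid (lin {h} {k} h∈ n₁ n₂ n₄ n₅ R) c =
    trans (sym (with-spoke h (r k) (spoke-absent h (r k) n₁ n₂))) (c h (r k) h∈) ,
    trans (sym (with-spoke h (r² k) (first-child h (r² k) R n₂))) (c h (r² k) h∈) ,
    trans (sym (with-spoke h (r³ k) (last-child h (r³ k) R n₄))) (c h (r³ k) h∈) ,
    trans (sym (with-spoke h (r⁴ k) (spoke-absent h (r⁴ k) n₄ n₅))) (c h (r⁴ k) h∈) ,
    valid R c
  valid (fork {h} {k} h∈ n₁ n₃ n₅ R Q) c =
    trans (sym (with-spoke h (r k) (first-child h (r k) R n₁))) (c h (r k) h∈) ,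
    trans (sym (with-spoke h (r² k) (last-child h (r² k) R n₃))) (c h (r² k) h∈) ,
    trans (sym (with-spoke h (r³ k) (first-child h (r³ k) Q n₃))) (c h (r³ k) h∈) ,
    trans (sym (with-spoke h (r⁴ k) (last-child h (r⁴ k) Q n₅))) (c h (r⁴ k) h∈) ,
    valid R c , valid Q c

  -- `Valid` is silent about the ends of the root edge, so they are assumed separately; for a branch
  -- they are corners of the parent hexagon, settled before descending.
  once-everywhere : ∀ {h k T} (R : Reg H h k T) → Valid (status R) →
                    Once M (vert h k) → Once M (vert h (r k)) → ∀ {b} → b ∈ hexes R → ∀ l → Once M (vert b l)
  once-everywhere (lin {h} {k} h∈ n₁ n₂ n₄ n₅ R) (c₁ , c₂ , c₃ , c₄ , v) o₀ o₁ = λ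
    { (here refl) → all-turns {P = λ l → Once M (vert h l)} k o₀ o₁ o₂ o₃ o₄ o₅
    ; (there b∈) → once-everywhere R v
        (subst (Once M) (sym (vert-nbr′ h (r³ k))) o₄) (subst (Once M) (sym (vert-nbr h (r³ k))) o₃) b∈ }
    where
      o₂ : Once M (vert h (r² k))
      o₂ = one⇒once h (r k) (trans (with-spoke h (r k) (spoke-absent h (r k) n₁ n₂)) c₁)
      o₃ : Once M (vert h (r³ k))
      o₃ = one⇒once h (r² k) (trans (with-spoke h (r² k) (first-child h (r² k) R n₂)) c₂)
      o₄ : Once M (vert h (r⁴ k))
      o₄ = one⇒once h (r³ k) (trans (with-spoke h (r³ k) (last-child h (r³ k) R n₄)) c₃)
      o₅ : Once M (vert h (r⁵ k))
      o₅ = one⇒once h (r⁴ k) (trans (with-spoke h (r⁴ k) (spoke-absent h (r⁴ k) n₄ n₅)) c₄)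
  once-everywhere (fork {h} {k} h∈ n₁ n₃ n₅ R Q) (c₁ , c₂ , c₃ , c₄ , v , v′) o₀ o₁ = λ
    { (here refl) → all-turns {P = λ l → Once M (vert h l)} k o₀ o₁ o₂ o₃ o₄ o₅
    ; (there b∈) → [ once-everywhere R v
        (subst (Once M) (sym (vert-nbr′ h (r² k))) o₃) (subst (Once M) (sym (vert-nbr h (r² k))) o₂)
      , once-everywhere Q v′
        (subst (Once M) (sym (vert-nbr′ h (r⁴ k))) o₅) (subst (Once M) (sym (vert-nbr h (r⁴ k))) o₄) ]′
        (∈-++⁻ (hexes R) b∈) }
    where
      o₂ : Once M (vert h (r² k))
      o₂ = one⇒once h (r k) (trans (with-spoke h (r k) (first-child h (r k) R n₁)) c₁)
      o₃ : Once M (vert h (r³ k))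
      o₃ = one⇒once h (r² k) (trans (with-spoke h (r² k) (last-child h (r² k) R n₃)) c₂)
      o₄ : Once M (vert h (r⁴ k))
      o₄ = one⇒once h (r³ k) (trans (with-spoke h (r³ k) (first-child h (r³ k) Q n₃)) c₃)
      o₅ : Once M (vert h (r⁵ k))
      o₅ = one⇒once h (r⁴ k) (trans (with-spoke h (r⁴ k) (last-child h (r⁴ k) Q n₅)) c₄)

  first-root : ∀ {h k T} (R : Reg H h k T) → h ∈ H → m (side h (r k)) ≡ firstEdge (status R)
  first-root (nil p)            h∈ = ⊥-elim (p h∈)
  first-root (lin _ _ _ _ _ _)  h∈ = refl
  first-root (fork _ _ _ _ _ _) h∈ = refl

  last-root : ∀ {h k T} (R : Reg H h k T) → h ∈ H → m (side h (r⁵ k)) ≡ lastEdge (status R)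
  last-root (nil p)            h∈ = ⊥-elim (p h∈)
  last-root (lin _ _ _ _ _ _)  h∈ = refl
  last-root (fork _ _ _ _ _ _) h∈ = refl

  module _ {h k T} (R : Reg H h k T) (h∈ : h ∈ H) (out : nbr h k ∉ H) (outʳ : nbr h (r k) ∉ H) (outˡ : nbr h (r⁵ k) ∉ H) where

    corner-first : corner-one h k ≡ one (m (side h k)) (firstEdge (status R)) false
    corner-first = trans (with-spoke h k (spoke-absent h k out outʳ))
      (cong (λ x → one (m (side h k)) x false) (first-root R h∈))

    corner-last : corner-one h (r⁵ k) ≡ one (lastEdge (status R)) (m (side h k)) false
    corner-last = trans (with-spoke h (r⁵ k) (spoke-absent h (r⁵ k) outˡ (subst (λ l → nbr h l ∉ H) (sym (r⁶ k)) out)))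
      (cong₂ (λ x l → one x (m (side h l)) false) (last-root R h∈) (r⁶ k))

    closed : (∀ h k → h ∈ H → corner-one h k ≡ true) → Closed (m (side h k)) (status R)
    closed c = trans (sym corner-first) (c h k h∈) , trans (sym corner-last) (c h (r⁵ k) h∈) , valid R c

    closed⇒once : Closed (m (side h k)) (status R) → ∀ {b} → b ∈ hexes R → ∀ l → Once M (vert b l)
    closed⇒once (p , q , v) = once-everywhere R v
      (subst (λ l → Once M (vert h l)) (r⁶ k) (one⇒once h (r⁵ k) (trans corner-last q)))
      (one⇒once h k (trans corner-first p))

module Matchings {H : List Hex} (ρ : Rooted H) where
  open Rooted ρ

  e₀ : Edge
  e₀ = side root dir

  pm⇒closed : ∀ {M} → All (IsEdge H) M → (∀ v → IsVertex H v → Once M v) →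
              Closed (has M e₀) (mapLab (has M) (labels region))
  pm⇒closed {M} M⊆ o = Local.closed M⊆ region root∈H out outʳ outˡ λ h k h∈ →
    Local.once⇒one M⊆ h k (o (vert h (r k)) (h , h∈ , vert∈hexVerts h (r k)))

  closed⇒pm : ∀ {M} → All (IsEdge H) M → Closed (has M e₀) (mapLab (has M) (labels region)) →
              ∀ v → IsVertex H v → Once M v
  closed⇒pm {M} M⊆ c v (b , b∈ , v∈) =
    let l , eq = ∈hexVerts⇒vert b v∈
    in subst (Once M) (sym eq) (Local.closed⇒once M⊆ region root∈H out outʳ outˡ c (cover b∈) l)

-- Anti-forcing sets as cuts

lab0-inj : ∀ {T} (m n : M0 T) → lab0 m ≡ lab0 n → m ≡ n
lab1-inj : ∀ {T} (p q : M1 T) → lab1 p ≡ lab1 q → p ≡ q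
labC-inj : ∀ {T} (x y : MC T) → rootBit x ≡ rootBit y → labC x ≡ labC y → x ≡ y

lin-inj : ∀ {A : Set} {B a b c d e a′ b′ c′ d′ e′} {l l′ : Lab A B} →
          Lab.lin a b c d e l ≡ lin a′ b′ c′ d′ e′ l′ → c ≡ c′ × l ≡ l′
lin-inj refl = refl , refl

fork-inj : ∀ {A : Set} {B C a b c d e a′ b′ c′ d′ e′} {l l′ : Lab A B} {n n′ : Lab A C} →
           Lab.fork a b c d e l n ≡ fork a′ b′ c′ d′ e′ l′ n′ → b ≡ b′ × d ≡ d′ × l ≡ l′ × n ≡ n′
fork-inj refl = refl , refl , refl , refl

lab0-inj nil nil eq = refl
lab0-inj (lin m) (lin n) eq = cong lin (lab0-inj m n (proj₂ (lin-inj eq)))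
lab0-inj (fork x y) (fork x′ y′) eq =
  let p , q , u , v = fork-inj eq in cong₂ fork (labC-inj x x′ p u) (labC-inj y y′ q v)
lab1-inj (lin x) (lin y) eq = let p , u = lin-inj eq in cong lin (labC-inj x y p u)
lab1-inj (fork m n) (fork m′ n′) eq =
  let _ , _ , u , v = fork-inj eq in cong₂ fork (lab0-inj m m′ u) (lab0-inj n n′ v)
labC-inj (incl m) (incl n) _ eq = cong incl (lab0-inj m n eq)
labC-inj (excl p) (excl q) _ eq = cong excl (lab1-inj p q eq)
labC-inj (incl m) (excl q) () _
labC-inj (excl q) (incl m) () _

Apart : Bool → Bool → Set
Apart a b = a ≡ true → b ≡ false

Apart* : ∀ {T} → Lab Bool T → Lab Bool T → Set
Apart* nil nil = ⊤
Apart* (lin a b c d e l) (lin a′ b′ c′ d′ e′ l′) =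
  Apart a a′ × Apart b b′ × Apart c c′ × Apart d d′ × Apart e e′ × Apart* l l′
Apart* (fork a b c d e l n) (fork a′ b′ c′ d′ e′ l′ n′) =
  Apart a a′ × Apart b b′ × Apart c c′ × Apart d d′ × Apart e e′ × Apart* l l′ × Apart* n n′

off : ∀ {b} → Apart false b
off ()

mutual
  -- Half of the identification of the recursive `Dis0` with the edgewise condition that no matching
  -- edge is cut, the form in which lists of edges provide it.
  dis0⇒apart : ∀ {T} (m : M0 T) s → Dis0 m s → Apart* (lab0 m) s
  dis0⇒apart nil nil _ = tt
  dis0⇒apart (lin m) (lin _ _ _ _ _ s) (p , q , d) =
    off , (λ _ → p) , off , (λ _ → q) , off , dis0⇒apart m s d
  dis0⇒apart (fork x y) (fork _ _ _ _ _ s t) (p , q) =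
    let a , b = disC⇒apart x _ s p
        c , d = disC⇒apart y _ t q
    in off , a , off , c , off , b , d

  dis1⇒apart : ∀ {T} (q : M1 T) s → Dis1 q s → Apart* (lab1 q) s
  dis1⇒apart (lin x) (lin _ _ _ _ _ s) (p , q , d) =
    let a , b = disC⇒apart x _ s d in (λ _ → p) , off , a , off , (λ _ → q) , b
  dis1⇒apart (fork m n) (fork _ _ _ _ _ s t) (p , q , u , d , d′) =
    (λ _ → p) , off , (λ _ → q) , off , (λ _ → u) , dis0⇒apart m s d , dis0⇒apart n t d′

  disC⇒apart : ∀ {T} (x : MC T) r s → DisC x r s → Apart (rootBit x) r × Apart* (labC x) s
  disC⇒apart (incl m) r s (p , d) = (λ _ → p) , dis0⇒apart m s d
  disC⇒apart (excl q)  r s d       = off , dis1⇒apart q s d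

mutual
  apart⇒dis0 : ∀ {T} (m : M0 T) s → Apart* (lab0 m) s → Dis0 m s
  apart⇒dis0 nil nil _ = tt
  apart⇒dis0 (lin m) (lin _ _ _ _ _ s) (_ , p , _ , q , _ , d) = p refl , q refl , apart⇒dis0 m s d
  apart⇒dis0 (fork x y) (fork _ _ _ _ _ s t) (_ , a , _ , c , _ , b , d) =
    apart⇒disC x _ s a b , apart⇒disC y _ t c d

  apart⇒dis1 : ∀ {T} (q : M1 T) s → Apart* (lab1 q) s → Dis1 q s
  apart⇒dis1 (lin x) (lin _ _ _ _ _ s) (p , _ , a , _ , q , b) = p refl , q refl , apart⇒disC x _ s a b
  apart⇒dis1 (fork m n) (fork _ _ _ _ _ s t) (p , _ , q , _ , u , d , d′) =
    p refl , q refl , u refl , apart⇒dis0 m s d , apart⇒dis0 n t d′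

  apart⇒disC : ∀ {T} (x : MC T) r s → Apart (rootBit x) r → Apart* (labC x) s → DisC x r s
  apart⇒disC (incl m) r s p d = p refl , apart⇒dis0 m s d
  apart⇒disC (excl q)  r s p d = apart⇒dis1 q s d

module _ {A : Set} {f g : A → Bool} where

  apart-map⁺ : ∀ {T} (L : Lab A T) → (∀ {e} → e ∈ toList L → Apart (f e) (g e)) → Apart* (mapLab f L) (mapLab g L)
  apart-map⁺ nil p = tt
  apart-map⁺ (lin a b c d e l) p =
    p (here refl) , p (there (here refl)) , p (there (there (here refl))) , p (there (there (there (here refl)))) ,
    p (there (there (there (there (here refl))))) , apart-map⁺ l (λ q → p (there (there (there (there (there q))))))
  apart-map⁺ (fork a b c d e l n) p =
    p (here refl) , p (there (here refl)) , p (there (there (here refl))) , p (there (there (there (here refl)))) ,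
    p (there (there (there (there (here refl))))) ,
    apart-map⁺ l (λ q → p (there (there (there (there (there (∈-++⁺ˡ q))))))) ,
    apart-map⁺ n (λ q → p (there (there (there (there (there (∈-++⁺ʳ (toList l) q)))))))

  apart-map⁻ : ∀ {T} (L : Lab A T) → Apart* (mapLab f L) (mapLab g L) → ∀ {e} → e ∈ toList L → Apart (f e) (g e)
  apart-map⁻ (lin _ _ _ _ _ l) (a , b , c , d , e , x) = λ
    { (here refl) → a ; (there (here refl)) → b ; (there (there (here refl))) → c
    ; (there (there (there (here refl)))) → d ; (there (there (there (there (here refl))))) → e
    ; (there (there (there (there (there q))))) → apart-map⁻ l x q }
  apart-map⁻ (fork _ _ _ _ _ l n) (a , b , c , d , e , x , y) = λ
    { (here refl) → a ; (there (here refl)) → b ; (there (there (here refl))) → c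
    ; (there (there (there (here refl)))) → d ; (there (there (there (there (here refl))))) → e
    ; (there (there (there (there (there q))))) → [ apart-map⁻ l x , apart-map⁻ n y ]′ (∈-++⁻ (toList l) q) }

toList-map : ∀ {A B : Set} {T} (f : A → B) (L : Lab A T) → toList (mapLab f L) ≡ map f (toList L)
toList-map f nil = refl
toList-map f (lin a b c d e l) = cong (λ z → f a ∷ f b ∷ f c ∷ f d ∷ f e ∷ z) (toList-map f l)
toList-map f (fork a b c d e l n) = cong (λ z → f a ∷ f b ∷ f c ∷ f d ∷ f e ∷ z)
  (trans (cong₂ _++_ (toList-map f l) (toList-map f n)) (sym (map-++ f (toList l) (toList n))))

length-toList : ∀ {A B : Set} {T} (l : Lab A T) (l′ : Lab B T) → length (toList l) ≡ length (toList l′)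
length-toList nil nil = refl
length-toList (lin _ _ _ _ _ l) (lin _ _ _ _ _ l′) = cong (5 +_) (length-toList l l′)
length-toList (fork _ _ _ _ _ l n) (fork _ _ _ _ _ l′ n′) = cong (5 +_)
  (trans (length-++ (toList l)) (trans (cong₂ _+_ (length-toList l l′) (length-toList n n′)) (sym (length-++ (toList l′)))))

++-split : ∀ {A : Set} (xs ys : List A) {us vs} → length xs ≡ length ys → xs ++ us ≡ ys ++ vs → xs ≡ ys × us ≡ vs
++-split []       []       _   eq = refl , eq
++-split (x ∷ xs) (y ∷ ys) len eq =
  let p , q = ∷-injective eq
      u , v = ++-split xs ys (suc-injective len) q
  in cong₂ _∷_ p u , v

toList-inj : ∀ {A : Set} {T} (l l′ : Lab A T) → toList l ≡ toList l′ → l ≡ l′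
toList-inj nil nil _ = refl
toList-inj (lin a b c d e l) (lin a′ b′ c′ d′ e′ l′) eq
  with refl , eq₁ ← ∷-injective eq with refl , eq₂ ← ∷-injective eq₁ with refl , eq₃ ← ∷-injective eq₂
  with refl , eq₄ ← ∷-injective eq₃ with refl , eq₅ ← ∷-injective eq₄ = cong (lin a b c d e) (toList-inj l l′ eq₅)
toList-inj (fork a b c d e l n) (fork a′ b′ c′ d′ e′ l′ n′) eq
  with refl , eq₁ ← ∷-injective eq with refl , eq₂ ← ∷-injective eq₁ with refl , eq₃ ← ∷-injective eq₂
  with refl , eq₄ ← ∷-injective eq₃ with refl , eq₅ ← ∷-injective eq₄ =
  let p , q = ++-split (toList l) (toList l′) (length-toList l l′) eq₅
  in cong₂ (fork a b c d e) (toList-inj l l′ p) (toList-inj n n′ q)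

count : List Bool → ℕ
count []       = 0
count (b ∷ bs) = bit b + count bs

count-++ : ∀ bs {cs} → count (bs ++ cs) ≡ count bs + count cs
count-++ []       = refl
count-++ (b ∷ bs) = trans (cong (bit b +_) (count-++ bs)) (sym (+-assoc (bit b) _ _))

+-assoc⁶ : ∀ a b c d e x → a + (b + (c + (d + e))) + x ≡ a + (b + (c + (d + (e + x))))
+-assoc⁶ = solve-∀

sz≡count : ∀ {T} (l : Lab Bool T) → sz l ≡ count (toList l)
sz≡count nil = refl
sz≡count (lin a b c d e l) = trans (cong (bits a b c d e +_) (sz≡count l))
  (+-assoc⁶ (bit a) (bit b) (bit c) (bit d) (bit e) (count (toList l)))
sz≡count (fork a b c d e l n) =
  trans (cong (bits a b c d e +_) (trans (cong₂ _+_ (sz≡count l) (sz≡count n)) (sym (count-++ (toList l)))))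
  (+-assoc⁶ (bit a) (bit b) (bit c) (bit d) (bit e) (count (toList l ++ toList n)))

select : ∀ {A : Set} → List A → List Bool → List A
select (x ∷ xs) (true ∷ bs)  = x ∷ select xs bs
select (x ∷ xs) (false ∷ bs) = select xs bs
select _        _            = []

select⊆ : ∀ {A : Set} {x : A} xs bs → x ∈ select xs bs → x ∈ xs
select⊆ (x ∷ xs) (true ∷ bs)  (here p)  = here p
select⊆ (x ∷ xs) (true ∷ bs)  (there q) = there (select⊆ xs bs q)
select⊆ (x ∷ xs) (false ∷ bs) q         = there (select⊆ xs bs q)

select-unique : ∀ {A : Set} {xs : List A} bs → Unique xs → Unique (select xs bs)
select-unique bs []                     = []
select-unique []           (p ∷ u)      = []
select-unique (true ∷ bs)  (p ∷ u)      = All.tabulate (λ q → All.lookup p (select⊆ _ bs q)) ∷ select-unique bs u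
select-unique (false ∷ bs) (p ∷ u)      = select-unique bs u

length-select : ∀ {A : Set} (xs : List A) bs → length xs ≡ length bs → length (select xs bs) ≡ count bs
length-select []       []           _  = refl
length-select (x ∷ xs) (true ∷ bs)  eq = cong suc (length-select xs bs (suc-injective eq))
length-select (x ∷ xs) (false ∷ bs) eq = length-select xs bs (suc-injective eq)

select-has⊆ : ∀ S xs {e} → e ∈ select xs (map (has S) xs) → e ∈ S
select-has⊆ S (x ∷ xs) q with has S x in eq
select-has⊆ S (x ∷ xs) (here refl) | true  = has⁻ eq
select-has⊆ S (x ∷ xs) (there q)   | true  = select-has⊆ S xs q
select-has⊆ S (x ∷ xs) q           | false = select-has⊆ S xs q

-- `M` is kept separate from `select xs bs` so that the induction may shorten `xs` while the list
-- being tested stays fixed.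
has-select : ∀ {xs} bs → Unique xs → length xs ≡ length bs →
             ∀ M → (∀ {e} → e ∈ xs → (e ∈ M → e ∈ select xs bs) × (e ∈ select xs bs → e ∈ M)) → map (has M) xs ≡ bs
has-select []           []      _  M eqv = refl
has-select (true ∷ bs)  (p ∷ u) eq M eqv = cong₂ _∷_ (has⁺ (proj₂ (eqv (here refl)) (here refl)))
  (has-select bs u (suc-injective eq) M λ q →
    (λ e∈ → drop (All.lookup p q) (proj₁ (eqv (there q)) e∈)) , λ s → proj₂ (eqv (there q)) (there s))
  where
    drop : ∀ {x e : Edge} {zs} → x ≢ e → e ∈ x ∷ zs → e ∈ zs
    drop x≢e (here refl) = ⊥-elim (x≢e refl)
    drop x≢e (there q)   = q
has-select {x ∷ xs} (false ∷ bs) (p ∷ u) eq M eqv = cong₂ _∷_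
  (hasn⁺ λ x∈ → All.lookup p (select⊆ xs bs (proj₁ (eqv (here refl)) x∈)) refl)
  (has-select bs u (suc-injective eq) M λ q → eqv (there q))

-- The spectrum is the set of values of `cv`

module Spectrum {H : List Hex} (ρ : Rooted H) where
  open Rooted ρ
  open Matchings ρ

  L : Lab Edge shape
  L = labels region

  es : List Edge
  es = e₀ ∷ toList L

  es-unique : Unique es
  es-unique = edges-unique region sep

  edge⇒∈ : ∀ {e} → IsEdge H e → e ∈ es
  edge⇒∈ p = let b , l , b∈ , q = edge⇒side p in subst (_∈ es) (sym q) (side⇒edges region (cover b∈) l)

  ∈⇒edge : ∀ {e} → e ∈ es → IsEdge H e
  ∈⇒edge (here refl) = root , root∈H , side∈hexEdges root dir
  ∈⇒edge (there q) with edges⇒side region q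
  ... | b , l , b∈ , refl = b , hexes⊆ region b∈ , side∈hexEdges b l

  Represents : List Edge → MC shape → Set
  Represents M x = rootBit x ≡ has M e₀ × labC x ≡ mapLab (has M) L

  selection : Bool → Lab Bool shape → List Edge
  selection b l = select es (b ∷ toList l)

  has-selection : ∀ b l → has (selection b l) e₀ ≡ b × mapLab (has (selection b l)) L ≡ l
  has-selection b l =
    let p , q = ∷-injective (has-select {es} (b ∷ toList l) es-unique (cong suc (length-toList L l)) (selection b l) λ _ → (λ z → z) , λ z → z)
    in p , toList-inj _ _ (trans (toList-map (has (selection b l)) L) q)

  selection⊆ : ∀ b l → All (IsEdge H) (selection b l)
  selection⊆ b l = All.tabulate λ q → ∈⇒edge (select⊆ es (b ∷ toList l) q)

  realise : MC shape → List Edge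
  realise x = selection (rootBit x) (labC x)

  realise-represents : ∀ x → Represents (realise x) x
  realise-represents x = let p , q = has-selection (rootBit x) (labC x) in sym p , sym q

  realise-covers : ∀ x v → IsVertex H v → Once (realise x) v
  realise-covers x = closed⇒pm (selection⊆ (rootBit x) (labC x))
    (let p , q = realise-represents x in subst₂ Closed p q (closedC x))

  represent : ∀ {M} → All (IsEdge H) M → (∀ v → IsVertex H v → Once M v) → ∃[ x ] Represents M x
  represent M⊆ o = closed⇒MC _ _ (pm⇒closed M⊆ o)

  same : ∀ {M M′ x} → All (IsEdge H) M → Represents M x → Represents M′ x → ∀ {e} → e ∈ M → e ∈ M′
  same {M} {M′} M⊆ (p , q) (p′ , q′) e∈ = has⁻ (trans (sym (agree (edge⇒∈ (All.lookup M⊆ e∈)))) (has⁺ e∈))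
    where
      go : ∀ xs → map (has M) xs ≡ map (has M′) xs → ∀ {e} → e ∈ xs → has M e ≡ has M′ e
      go (x ∷ xs) eq (here refl) = proj₁ (∷-injective eq)
      go (x ∷ xs) eq (there q)   = go xs (proj₂ (∷-injective eq)) q
      agree : ∀ {e} → e ∈ es → has M e ≡ has M′ e
      agree = go es (cong₂ _∷_ (trans (sym p) p′)
        (trans (sym (toList-map (has M) L)) (trans (cong toList (trans (sym q) q′)) (toList-map (has M′) L))))

  avoids⇒dis : ∀ {M S x} → Represents M x → (∀ {e} → e ∈ M → e ∉ S) → DisC x (has S e₀) (mapLab (has S) L)
  avoids⇒dis {M} {S} {x} (p , q) av = apart⇒disC x _ _
    (λ r → hasn⁺ (av (has⁻ {M} (trans (sym p) r))))
    (subst (λ l → Apart* l (mapLab (has S) L)) (sym q) (apart-map⁺ L λ _ t → hasn⁺ (av (has⁻ {M} t))))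

  dis⇒avoids : ∀ {M S x} → All (IsEdge H) M → Represents M x → DisC x (has S e₀) (mapLab (has S) L) → ∀ {e} → e ∈ M → e ∉ S
  dis⇒avoids {M} {S} {x} M⊆ (p , q) d e∈M e∈S with disC⇒apart x _ _ d | edge⇒∈ (All.lookup M⊆ e∈M)
  ... | a , _ | here refl = clash (has⁺ e∈S) (a (trans p (has⁺ e∈M)))
  ... | _ , a | there e∈  = clash (has⁺ e∈S)
    (apart-map⁻ L (subst (λ l → Apart* l (mapLab (has S) L)) q a) e∈ (has⁺ e∈M))

  -- Any `y` that survives the cut given by `S` is realised by a perfect matching avoiding `S`,
  -- which the anti-forcing property identifies with `M`. So `x` is unique for this cut and `lb-c`
  -- applies.
  lower : ∀ {M x} → All (IsEdge H) M → Represents M x → ∀ S → AntiForcingSet H M S → cv x ≤ length S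
  lower {M} {x} M⊆ rep S (_ , S⊆ , forced) =
    ≤-trans (lb-c x (has S e₀) (mapLab (has S) L)
      (avoids⇒dis rep (λ e∈M e∈S → proj₂ (All.lookup S⊆ e∈S) e∈M) , unique))
      (≤-trans (≤-reflexive sizes) (unique⊆⇒length≤ (select-unique (map (has S) es) es-unique) (select-has⊆ S es)))
    where
      unique : ∀ y → DisC y (has S e₀) (mapLab (has S) L) → y ≡ x
      unique y d = labC-inj y x
        (trans (proj₁ ry) (trans (agree e₀) (sym (proj₁ rep))))
        (trans (proj₂ ry) (trans (maps L) (sym (proj₂ rep))))
        where
          M′ : List Edge
          M′ = realise y
          ry : Represents M′ y
          ry = realise-represents y
          M′⊆ : All (IsEdge H) M′
          M′⊆ = selection⊆ (rootBit y) (labC y)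
          eqv : ∀ e → e ∈ M′ ⇔ e ∈ M
          eqv = forced M′
            ( select-unique (rootBit y ∷ toList (labC y)) es-unique
            , All.tabulate (λ q → All.lookup M′⊆ q , dis⇒avoids M′⊆ ry d q)
            , realise-covers y )
          agree : ∀ e → has M′ e ≡ has M e
          agree e with has M′ e in p | has M e in q
          ... | true  | true  = refl
          ... | false | false = refl
          ... | true  | false = ⊥-elim (clash (has⁺ (Equivalence.to (eqv e) (has⁻ p))) q)
          ... | false | true  = ⊥-elim (clash (has⁺ (Equivalence.from (eqv e) (has⁻ q))) p)
          maps : ∀ {T} (K : Lab Edge T) → mapLab (has M′) K ≡ mapLab (has M) K
          maps K = toList-inj _ _ (trans (toList-map (has M′) K) (trans (map-cong agree (toList K)) (sym (toList-map (has M) K))))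
      sizes : bit (has S e₀) + sz (mapLab (has S) L) ≡ length (select es (map (has S) es))
      sizes = trans (cong (bit (has S e₀) +_) (trans (sz≡count (mapLab (has S) L)) (cong count (toList-map (has S) L))))
                    (sym (length-select es (map (has S) es) (sym (length-map (has S) es))))

  upper : ∀ {M x} → All (IsEdge H) M → Represents M x → ∃[ S ] (AntiForcingSet H M S × length S ≤ cv x)
  upper {M} {x} M⊆ rep with ub-c x
  ... | b , s , (d , u) , size =
    S , ( select-unique (b ∷ toList s) es-unique
        , All.tabulate (λ e∈S → All.lookup (selection⊆ b s) e∈S , λ e∈M → dis⇒avoids {M} {S} M⊆ rep (shift {x} d) e∈M e∈S)
        , forced )
    , ≤-trans (≤-reflexive (trans (length-select es (b ∷ toList s) (cong suc (length-toList L s)))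
                                  (cong (bit b +_) (sym (sz≡count s))))) size
    where
      S : List Edge
      S = selection b s
      shift : ∀ {y} → DisC y b s → DisC y (has S e₀) (mapLab (has S) L)
      shift {y} = let p , q = has-selection b s in subst₂ (DisC y) (sym p) (sym q)
      unshift : ∀ {y} → DisC y (has S e₀) (mapLab (has S) L) → DisC y b s
      unshift {y} = let p , q = has-selection b s in subst₂ (DisC y) p q
      forced : ∀ M′ → PerfectMatchingOf H (λ e → IsEdge H e × e ∉ S) M′ → ∀ e → e ∈ M′ ⇔ e ∈ M
      forced M′ (_ , M′⊆S , o) e =
        let M′⊆ = All.map proj₁ M′⊆S
            y , ry = represent M′⊆ o
            -- Each perfect matching avoiding `S` is represented by some `y` that survives the
            -- optimal cut, hence by `x`.
            eq = u y (unshift {y} (avoids⇒dis ry λ e∈ → proj₂ (All.lookup M′⊆S e∈)))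
            rx = subst (Represents M′) eq ry
        in mk⇔ (same M′⊆ rx rep) (same M⊆ rep rx)

  af-number : ∀ {M x} → All (IsEdge H) M → Represents M x → AntiForcingNumber H M (cv x)
  af-number M⊆ rep =
    let S , af , size = upper M⊆ rep
    in (S , af , ≤-antisym size (lower M⊆ rep S af)) , lower M⊆ rep

  spectrum⇒ : ∀ {k} → InSpecAf H k → ∃[ x ] cv {shape} x ≡ k
  spectrum⇒ (M , (_ , M⊆ , o) , (S , af , refl) , min) =
    let x , rep = represent M⊆ o
        (S′ , af′ , eq) , mincl = af-number M⊆ rep
    in x , ≤-antisym (mincl S af) (≤-trans (min S′ af′) (≤-reflexive eq))

  spectrum⇐ : ∀ {k} → ∃[ x ] cv {shape} x ≡ k → InSpecAf H k
  spectrum⇐ (x , refl) = realise x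
    , (select-unique (rootBit x ∷ toList (labC x)) es-unique , selection⊆ (rootBit x) (labC x) , realise-covers x)
    , af-number (selection⊆ (rootBit x) (labC x)) (realise-represents x)

theorem3p1 : (H : List Hex) → CataCondensed H → ContinuousSpecAf H
theorem3p1 H cata =
  let open Spectrum (rooted cata)
      a , b , a≤b , bounds , hits = cv-interval _
  in a , b , a≤b , λ k → mk⇔ (λ p → bounds k (spectrum⇒ p)) (λ (p , q) → spectrum⇐ (hits k p q))
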